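{- For every forest of cycles $F$ and every integer $n\geq 5$ with $n\geq |F|$, there exists $G\in\mathcal{M}(\mathcal{C})$ such that: (1) $|G|=n$; (2) $F$ is a subgraph of $G$; (3) every cycle-monochromatic $2$-edge-colouring of $F$ extends to a $2$-edge-colouring of $G$ in which there are no monochromatic cycles other than those already in $F$.
   Context: All graphs are finite and simple; $|H|$ denotes the number of vertices of $H$. $\mathcal{R}(\mathcal{C})$ is the class of graphs $G$ such that every $2$-colouring of the edges of $G$ admits a monochromatic cycle (of any length); $\mathcal{M}(\mathcal{C})$ is the class of graphs in $\mathcal{R}(\mathcal{C})$ no proper subgraph of which is in $\mathcal{R}(\mathcal{C})$. A forest of cycles is a graph (without isolated vertices) obtained by starting with a disjoint union of one or more cycles built as follows: start with a cycle and then recursively adjoin a further cycle by identifying at most one of its vertices with a vertex of the already existing cycles. Every edge of a forest of cycles lies in exactly one of its cycles; a $2$-edge-colouring of $F$ is cycle-monochromatic if every cycle of $F$ is monochromatic (the colours of different cycles chosen independently). -}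

module Defs where

open import Data.Nat using (ℕ; _≤_)
open import Data.Fin using (Fin)
open import Data.Bool using (Bool; true; false)
open import Data.List using (List; []; _∷_; _++_; [_]; length)
open import Data.List.Relation.Unary.Any using (Any)
open import Data.List.Relation.Unary.All using (All)
open import Data.List.Relation.Unary.Linked using (Linked)
open import Data.List.Relation.Unary.Unique.Propositional using (Unique)
open import Data.List.Membership.Propositional using (_∈_)
open import Data.Product using (Σ; ∃; ∃₂; _×_; _,_)
open import Data.Sum using (_⊎_)
open import Data.Empty using (⊥)
open import Data.Unit using (⊤)
open import Relation.Nullary using (¬_)
open import Relation.Binary.PropositionalEquality using (_≡_; _≢_)

record Graph (n : ℕ) : Set where
  field
    adj    : Fin n → Fin n → Bool
    sym    : ∀ u v → adj u v ≡ adj v u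
    irrefl : ∀ v → adj v v ≡ false

open Graph public

E : ∀ {n} → Graph n → Fin n → Fin n → Set
E G u v = adj G u v ≡ true

closeUp : ∀ {A : Set} → List A → List A
closeUp []       = []
closeUp (x ∷ xs) = x ∷ xs ++ [ x ]

data Consec {A : Set} : List A → A → A → Set where
  here  : ∀ {x y zs} → Consec (x ∷ y ∷ zs) x y
  there : ∀ {x ys u v} → Consec ys u v → Consec (x ∷ ys) u v

CycleEdge : ∀ {A : Set} → List A → A → A → Set
CycleEdge C u v = Consec (closeUp C) u v ⊎ Consec (closeUp C) v u

IsCycle : ∀ {n} → Graph n → List (Fin n) → Set
IsCycle G []       = ⊥
IsCycle G (x ∷ xs) =
  (2 ≤ length xs) × Unique (x ∷ xs) × Linked (E G) (closeUp (x ∷ xs))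

-- 2-edge-colourings: a symmetric map assigning a colour (Bool) to each
-- pair; only its values on edges matter.

SymColouring : ℕ → Set
SymColouring n = Σ (Fin n → Fin n → Bool) λ c → ∀ u v → c u v ≡ c v u

col : ∀ {n} → SymColouring n → Fin n → Fin n → Bool
col (c , _) = c

Monochromatic : ∀ {n} → SymColouring n → List (Fin n) → Set
Monochromatic c C = ∃ λ b → Linked (λ u v → col c u v ≡ b) (closeUp C)

InR : ∀ {n} → Graph n → Set
InR G = ∀ (c : SymColouring _) → ∃ λ D → IsCycle G D × Monochromatic c D

IsSubgraphVia : ∀ {m n} → Graph m → Graph n → (Fin m → Fin n) → Set
IsSubgraphVia H G φ =
  (∀ u v → φ u ≡ φ v → u ≡ v) × (∀ u v → E H u v → E G (φ u) (φ v))

ProperVia : ∀ {m n} → Graph m → Graph n → (Fin m → Fin n) → Set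
ProperVia H G φ =
  (∃ λ w → ∀ u → φ u ≢ w)
  ⊎ (∃₂ λ u v → adj H u v ≡ false × E G (φ u) (φ v))

InM : ∀ {n} → Graph n → Set
InM {n} G = InR G ×
  (∀ m (H : Graph m) (φ : Fin m → Fin n) →
     IsSubgraphVia H G φ → ProperVia H G φ → ¬ InR H)

-- Forests of cycles.
-- A list  C_k ∷ … ∷ C_1 ∷ []  of cycles is "well built" if each cycle
-- C_{i} shares at most one vertex with the union of C_1 … C_{i-1}
-- (the list is stored with the most recently adjoined cycle first).

AtMostOneShared : ∀ {n} → List (Fin n) → List (List (Fin n)) → Set
AtMostOneShared C Cs = ∀ u v → u ∈ C → v ∈ C →
  Any (u ∈_) Cs → Any (v ∈_) Cs → u ≡ v

WellBuilt : ∀ {n} → List (List (Fin n)) → Set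
WellBuilt []       = ⊤
WellBuilt (C ∷ Cs) = AtMostOneShared C Cs × WellBuilt Cs

record ForestOfCycles (m : ℕ) : Set where
  field
    graph     : Graph m
    cycles    : List (List (Fin m))
    nonempty  : 1 ≤ length cycles
    areCycles : All (IsCycle graph) cycles
    built     : WellBuilt cycles
    edges     : ∀ u v → E graph u v → Any (λ C → CycleEdge C u v) cycles
    covers    : ∀ v → Any (v ∈_) cycles

open ForestOfCycles public

CycleMonochromatic : ∀ {m} → ForestOfCycles m → SymColouring m → Set
CycleMonochromatic F c = All (Monochromatic c) (cycles F)

{-# OPTIONS --safe #-}
module Submission where

-- A graph on n vertices with 2n - 1 edges has a monochromatic cycle in every 2-colouring, because a
-- forest on n vertices has at most n - 1 edges. If moreover deleting any single edge leaves a union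
-- of two forests, the graph is minimal. Both properties survive the operation "delete an edge uv
-- and add a vertex w adjacent to u, v and some z": colour wu, wv like uv, and wz differently.
--
-- The cycles of F are added one at a time by this operation. Applied to an edge outside F it adds a
-- vertex outside F; applied to an edge of a cycle of F it lengthens that cycle; applied twice it
-- adds a triangle through an existing vertex x, in place of an edge uv outside F that avoids x. In
-- each case a colouring whose monochromatic cycles all belong to F is extended to the new graph. An
-- edge uv as needed exists because two disjoint edges outside F are maintained throughout.
--
-- The starting graph is K₅ minus an edge, containing the only cycle of F or the first two cycles if
-- these meet, or else a graph on 6 vertices containing two disjoint triangles. Cycles that do not
-- fit are first shortened.

-- The tight constraint is the number of vertices: when `n = |F|`, no vertex of the graph may lie
-- outside `F`. A lengthening adds one vertex, a triangle through an old vertex adds two, and a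
-- later cycle disjoint from the rest pays separately for its first vertex, so growth wastes
-- nothing; only the starting graph could. A triangle placed alone in five vertices leaves two of
-- them off the family. This is why two cycles are started together: two meeting triangles fill five
-- vertices, two disjoint ones fill six. For a single cycle, the hypothesis `5 ≤ n` pays for the
-- vertices outside it.
--
-- The third neighbour `z` of `w` keeps the edge count right: one more vertex calls for two more
-- edges, and replacing `uv` by a path gains only one. With the colour opposite to that of `uv`, the
-- edge `wz` is the only edge of its class at `w`, so it lies on no monochromatic cycle, while the
-- class of `uv` is merely subdivided.

open import Defs
open import Data.Bool using (Bool; true; false; not; if_then_else_)
import Data.Bool.Properties as Bool
open import Data.Empty using (⊥; ⊥-elim)
open import Data.Fin using (Fin; zero; suc; _≟_; inject≤)
open import Data.Fin.Patterns using (0F; 1F; 2F; 3F; 4F; 5F)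
open import Data.Fin.Properties using (any?; all?; inject≤-injective; injective⇒≤)
open import Data.List
  using (List; []; _∷_; _++_; [_]; length; map; filter; allFin; lookup; initLast; _∷ʳ′_)
open import Data.List.Membership.Propositional using (_∈_; _∉_)
open import Data.List.Membership.Propositional.Properties
  using (∈-∃++; ∈-++⁺ˡ; ∈-++⁺ʳ; ∈-++⁻; ∈-map⁺; ∈-map⁻; ∈-filter⁻; ∈-allFin; ∈-lookup)
open import Data.List.Properties
  using (++-assoc; ++-identityʳ; map-++; length-++-sucʳ; length-map; length-tabulate)
open import Data.List.Relation.Binary.Permutation.Propositional as ↭ using (_↭_; ↭⇒↭ₛ; ↭-sym)
open import Data.List.Relation.Binary.Permutation.Propositional.Properties using (++-comm; ↭-length; ∈-resp-↭)
import Data.List.Relation.Binary.Permutation.Setoid.Properties as Permutationₛ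
open import Data.List.Relation.Unary.All as All using (All; []; _∷_)
import Data.List.Relation.Unary.All.Properties as All
open import Data.List.Relation.Unary.AllPairs using ([]; _∷_)
open import Data.List.Relation.Unary.Any as Any using (Any; here; there)
import Data.List.Relation.Unary.Any.Properties as Any
open import Data.List.Relation.Unary.Linked using (Linked; []; [-]; _∷_)
open import Data.List.Relation.Unary.Unique.Propositional using (Unique)
import Data.List.Relation.Unary.Unique.Propositional.Properties as Unique
open import Data.Nat using (ℕ; zero; suc; _+_; _≤_; _<_; z≤n; s≤s)
import Data.Nat.Properties as ℕ
open import Data.Product using (Σ; ∃; ∃₂; _×_; _,_; proj₁; proj₂)
open import Data.Sum using (_⊎_; inj₁; inj₂; swap; [_,_]′)
import Data.Sum as Sum
open import Data.Unit using (⊤; tt)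
open import Function using (_∘_; id; mk⇔)
open import Relation.Binary.Construct.Closure.ReflexiveTransitive as Star using (Star; ε; _◅_; _◅◅_)
open import Relation.Nullary using (¬_; Dec; yes; no; does)
open import Relation.Nullary.Decidable
  using (_×-dec_; _⊎-dec_; _→-dec_; ¬?; map′; dec-true; dec-false; True; toWitness; does-⇔)
open import Relation.Binary.PropositionalEquality
  using (_≡_; _≢_; refl; trans; cong; cong₂; subst; subst₂; ≢-sym)
  renaming (sym to ≡-sym; setoid to ≡-setoid)

private variable
  n : ℕ
  A B : Set

Rel : ℕ → Set₁
Rel n = Fin n → Fin n → Set

Symmetric : Rel n → Set
Symmetric R = ∀ {p q} → R p q → R q p

-- Consecutive elements and cycles

consec-++ˡ : {l m : List A} {p q : A} → Consec l p q → Consec (l ++ m) p q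
consec-++ˡ here      = here
consec-++ˡ (there e) = there (consec-++ˡ e)

consec-∷ʳ⁺ : (l : List A) {x y : A} → Consec ((l ++ [ x ]) ++ [ y ]) x y
consec-∷ʳ⁺ []      = here
consec-∷ʳ⁺ (_ ∷ l) = there (consec-∷ʳ⁺ l)

consec-∷ʳ⁻ : (l : List A) {x y p q : A} → Consec ((l ++ [ x ]) ++ [ y ]) p q →
             Consec (l ++ [ x ]) p q ⊎ (p ≡ x × q ≡ y)
consec-∷ʳ⁻ []          here      = inj₂ (refl , refl)
consec-∷ʳ⁻ (_ ∷ [])    here      = inj₁ here
consec-∷ʳ⁻ (_ ∷ _ ∷ _) here      = inj₁ here
consec-∷ʳ⁻ []          (there (there ()))
consec-∷ʳ⁻ (_ ∷ l)     (there e) = Sum.map₁ there (consec-∷ʳ⁻ l e)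

consec-∈ˡ : {l : List A} {p q : A} → Consec l p q → p ∈ l
consec-∈ˡ here      = here refl
consec-∈ˡ (there e) = there (consec-∈ˡ e)

consec-∈ʳ : {l : List A} {p q : A} → Consec l p q → q ∈ l
consec-∈ʳ here      = there (here refl)
consec-∈ʳ (there e) = there (consec-∈ʳ e)

consec-map⁺ : (f : A → B) {l : List A} {p q : A} → Consec l p q → Consec (map f l) (f p) (f q)
consec-map⁺ f here      = here
consec-map⁺ f (there e) = there (consec-map⁺ f e)

consec-map⁻ : (f : A → B) (l : List A) {p q : B} → Consec (map f l) p q →
              ∃₂ λ u v → Consec l u v × f u ≡ p × f v ≡ q
consec-map⁻ f (x ∷ y ∷ l) here      = x , y , here , refl , refl
consec-map⁻ f (x ∷ l)     (there e) =
  let u , v , e′ , eq = consec-map⁻ f l e in u , v , there e′ , eq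

linked⇒consec : {R : A → A → Set} {l : List A} → Linked R l → ∀ {p q} → Consec l p q → R p q
linked⇒consec [-]      (there ())
linked⇒consec (r ∷ _)  here      = r
linked⇒consec (_ ∷ rs) (there e) = linked⇒consec rs e

consec⇒linked : {R : A → A → Set} (l : List A) → (∀ {p q} → Consec l p q → R p q) → Linked R l
consec⇒linked []          f = []
consec⇒linked (_ ∷ [])    f = [-]
consec⇒linked (_ ∷ _ ∷ l) f = f here ∷ consec⇒linked _ (f ∘ there)

map-closeUp : (f : A → B) (l : List A) → map f (closeUp l) ≡ closeUp (map f l)
map-closeUp f []      = refl
map-closeUp f (x ∷ l) = cong (f x ∷_) (map-++ f l [ x ])

cycleEdge-map⁺ : (f : A → B) {C : List A} {p q : A} → CycleEdge C p q → CycleEdge (map f C) (f p) (f q)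
cycleEdge-map⁺ f {C} = Sum.map go go
  where
  go : ∀ {p q} → Consec (closeUp C) p q → Consec (closeUp (map f C)) (f p) (f q)
  go e = subst (λ l → Consec l _ _) (map-closeUp f C) (consec-map⁺ f e)

cycleEdge-map⁻ : (f : A → B) (C : List A) {p q : B} → CycleEdge (map f C) p q →
                 ∃₂ λ u v → CycleEdge C u v × f u ≡ p × f v ≡ q
cycleEdge-map⁻ f C (inj₁ e) =
  let u , v , e′ , eq = consec-map⁻ f (closeUp C) (subst (λ l → Consec l _ _) (≡-sym (map-closeUp f C)) e)
  in u , v , inj₁ e′ , eq
cycleEdge-map⁻ f C (inj₂ e) =
  let u , v , e′ , eq₁ , eq₂ = consec-map⁻ f (closeUp C) (subst (λ l → Consec l _ _) (≡-sym (map-closeUp f C)) e)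
  in v , u , inj₂ e′ , eq₂ , eq₁

closeUp-∈ : {D : List A} {p : A} → p ∈ closeUp D → p ∈ D
closeUp-∈ {D = x ∷ D} (here px) = here px
closeUp-∈ {D = x ∷ D} (there i) with ∈-++⁻ D i
... | inj₁ j         = there j
... | inj₂ (here px) = here px

cycleEdge-∈ˡ : {C : List A} {p q : A} → CycleEdge C p q → p ∈ C
cycleEdge-∈ˡ (inj₁ e) = closeUp-∈ (consec-∈ˡ e)
cycleEdge-∈ˡ (inj₂ e) = closeUp-∈ (consec-∈ʳ e)

cycleEdge-∈ʳ : {C : List A} {p q : A} → CycleEdge C p q → q ∈ C
cycleEdge-∈ʳ = cycleEdge-∈ˡ ∘ swap

rotate₁ : (x : A) (l : List A) {p q : A} → Consec (closeUp (x ∷ l)) p q → Consec (closeUp (l ++ [ x ])) p q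
rotate₁ x []       e         = e
rotate₁ x (y ∷ ys) here      = consec-∷ʳ⁺ (y ∷ ys)
rotate₁ x (y ∷ ys) (there e) = consec-++ˡ e

rotate : (l : List A) {m : List A} {p q : A} → Consec (closeUp (l ++ m)) p q → Consec (closeUp (m ++ l)) p q
rotate []      {m} e = subst (λ l → Consec (closeUp l) _ _) (≡-sym (++-identityʳ m)) e
rotate (x ∷ l) {m} e =
  subst (λ l → Consec (closeUp l) _ _) (++-assoc m [ x ] l)
    (rotate l (subst (λ l → Consec (closeUp l) _ _) (++-assoc l m [ x ]) (rotate₁ x (l ++ m) e)))

-- The relation is arbitrary so that colour classes, graphs with a deleted edge and the edges of a
-- path are treated alike; a monochromatic cycle is a `Cycle` of one colour class.
record Cycle {n} (R : Rel n) (D : List (Fin n)) : Set where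
  field
    long   : 3 ≤ length D
    unique : Unique D
    steps  : ∀ {p q} → Consec (closeUp D) p q → R p q

cycle-mono : {R R′ : Rel n} {D : List (Fin n)} → (∀ {p q} → p ∈ D → q ∈ D → R p q → R′ p q) →
             Cycle R D → Cycle R′ D
cycle-mono f cyc = record
  { long = long ; unique = unique
  ; steps = λ e → f (closeUp-∈ (consec-∈ˡ e)) (closeUp-∈ (consec-∈ʳ e)) (steps e) }
  where open Cycle cyc

cycle-off : {R R′ : Rel n} {w : Fin n} {D : List (Fin n)} → w ∉ D →
            (∀ {p q} → p ≢ w → q ≢ w → R p q → R′ p q) → Cycle R D → Cycle R′ D
cycle-off w∉D f = cycle-mono (λ p∈ q∈ → f (λ { refl → w∉D p∈ }) (λ { refl → w∉D q∈ }))

-- The cycle cut open at `w`: `y` and `y′` are its neighbours there, and `rest` is the path between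
-- them. `steps` refers to `D` as given, in whatever rotation.
record Through {n} (R : Rel n) (w : Fin n) (D : List (Fin n)) : Set where
  field
    y y′  : Fin n
    m     : List (Fin n)
  rest : List (Fin n)
  rest = y ∷ m ++ [ y′ ]
  field
    unique : Unique rest
    fresh  : w ∉ rest
    first  : R w y
    last   : R y′ w
    inner  : ∀ {p q} → Consec rest p q → R p q
    steps  : ∀ {p q} → Consec (closeUp D) p q → (p ≡ w × q ≡ y) ⊎ (p ≡ y′ × q ≡ w) ⊎ Consec rest p q

  y≢y′ : y ≢ y′
  y≢y′ eq = Unique.Unique[x∷xs]⇒x∉xs unique (∈-++⁺ʳ m (here eq))

unique-↭ : {l m : List A} → l ↭ m → Unique l → Unique m
unique-↭ l↭m = Permutationₛ.Unique-resp-↭ (≡-setoid _) (↭⇒↭ₛ l↭m)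

through-head : {R : Rel n} {w : Fin n} {l : List (Fin n)} → Cycle R (w ∷ l) → Through R w (w ∷ l)
through-head {l = l} cyc with initLast l
through-head cyc | []             with s≤s () ← Cycle.long cyc
through-head cyc | [] ∷ʳ′ _       with s≤s (s≤s ()) ← Cycle.long cyc
through-head {R = R} {w} cyc | (y ∷ m) ∷ʳ′ y′ with u@(_ ∷ urest) ← Cycle.unique cyc = record
  { y = y ; y′ = y′ ; m = m
  ; unique = urest
  ; fresh  = Unique.Unique[x∷xs]⇒x∉xs u
  ; first  = steps here
  ; last   = steps (consec-∷ʳ⁺ (w ∷ y ∷ m))
  ; inner  = λ e → steps (there (consec-++ˡ e))
  ; steps  = split }
  where
  open Cycle cyc using (steps)
  split : ∀ {p q} → Consec (closeUp (w ∷ y ∷ m ++ [ y′ ])) p q →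
          (p ≡ w × q ≡ y) ⊎ (p ≡ y′ × q ≡ w) ⊎ Consec (y ∷ m ++ [ y′ ]) p q
  split here = inj₁ (refl , refl)
  split (there e) with consec-∷ʳ⁻ (y ∷ m) e
  ... | inj₁ e′ = inj₂ (inj₂ e′)
  ... | inj₂ eq = inj₂ (inj₁ eq)

through : {R : Rel n} {w : Fin n} {D : List (Fin n)} → Cycle R D → w ∈ D → Through R w D
through {w = w} cyc w∈D with ∈-∃++ w∈D
... | as , bs , refl = record { Through th hiding (steps) ; steps = λ e → Through.steps th (rotate as e) }
  where
  perm : as ++ w ∷ bs ↭ w ∷ bs ++ as
  perm = ++-comm as (w ∷ bs)
  th : Through _ w (w ∷ bs ++ as)
  th = through-head record
    { long   = subst (3 ≤_) (↭-length perm) (Cycle.long cyc)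
    ; unique = unique-↭ perm (Cycle.unique cyc)
    ; steps  = λ e → Cycle.steps cyc (rotate (w ∷ bs) e) }

-- A cycle enters and leaves `w` through two different vertices.
leaf : {R : Rel n} {w : Fin n} {D : List (Fin n)} → Symmetric R →
       (∀ {q r} → R w q → R w r → q ≡ r) → Cycle R D → w ∉ D
leaf R-sym ≤1 cyc w∈D = y≢y′ (≤1 first (R-sym last))
  where open Through (through cyc w∈D)

Same : Fin n → Fin n → Rel n
Same u v p q = (p ≡ u × q ≡ v) ⊎ (p ≡ v × q ≡ u)

Triangle : Fin n → Fin n → Fin n → Rel n
Triangle w u v p q = Same w u p q ⊎ Same w v p q ⊎ Same u v p q

-- Suppressing a vertex w of degree two in a cycle: its neighbours u, v become adjacent.
record Shortcut {n} (R : Rel n) (w u v : Fin n) (D : List (Fin n)) : Set where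
  field
    D′    : List (Fin n)
    cycle : Cycle (λ p q → (p ≢ w × q ≢ w × R p q) ⊎ Same u v p q) D′
    uses  : CycleEdge D′ u v
    steps : ∀ {p q} → Consec (closeUp D) p q →
            Same w u p q ⊎ Same w v p q ⊎ (p ≢ w × q ≢ w × Consec (closeUp D′) p q)

module _ {R : Rel n} {w u v : Fin n} (R-sym : Symmetric R)
         (nbr : ∀ {q} → R w q → q ≡ u ⊎ q ≡ v) where

  ends : ∀ {D} (th : Through R w D) → let open Through th in Same u v y y′
  ends th with nbr (Through.first th) | nbr (R-sym (Through.last th))
  ... | inj₁ p | inj₁ q = ⊥-elim (Through.y≢y′ th (trans p (≡-sym q)))
  ... | inj₁ p | inj₂ q = inj₁ (p , q)
  ... | inj₂ p | inj₁ q = inj₂ (p , q)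
  ... | inj₂ p | inj₂ q = ⊥-elim (Through.y≢y′ th (trans p (≡-sym q)))

  shortcut : ∀ {D} → Cycle R D → w ∈ D →
             (R u v × (∀ {p q} → Consec (closeUp D) p q → Triangle w u v p q))
             ⊎ Shortcut R w u v D
  shortcut {D} cyc w∈D = go (through cyc w∈D)
    where
    go : Through R w D →
         (R u v × (∀ {p q} → Consec (closeUp D) p q → Triangle w u v p q)) ⊎ Shortcut R w u v D
    -- `D` is a triangle, and suppressing `w` would leave only two vertices; instead `u` and `v` are
    -- already adjacent.
    go th@(record { m = [] ; inner = inner ; steps = steps }) with ends th
    ... | inj₁ (refl , refl) = inj₁ (inner here , λ e → edge (steps e))
      where
      edge : ∀ {p q} → (p ≡ w × q ≡ u) ⊎ (p ≡ v × q ≡ w) ⊎ Consec (u ∷ v ∷ []) p q → Triangle w u v p q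
      edge (inj₁ eq)               = inj₁ (inj₁ eq)
      edge (inj₂ (inj₁ eq))        = inj₂ (inj₁ (inj₂ eq))
      edge (inj₂ (inj₂ here))      = inj₂ (inj₂ (inj₁ (refl , refl)))
      edge (inj₂ (inj₂ (there (there ()))))
    ... | inj₂ (refl , refl) = inj₁ (R-sym (inner here) , λ e → edge (steps e))
      where
      edge : ∀ {p q} → (p ≡ w × q ≡ v) ⊎ (p ≡ u × q ≡ w) ⊎ Consec (v ∷ u ∷ []) p q → Triangle w u v p q
      edge (inj₁ eq)               = inj₂ (inj₁ (inj₁ eq))
      edge (inj₂ (inj₁ eq))        = inj₁ (inj₂ eq)
      edge (inj₂ (inj₂ here))      = inj₂ (inj₂ (inj₂ (refl , refl)))
      edge (inj₂ (inj₂ (there (there ()))))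
    -- `rest` has at least three vertices, so the new edge `uv` closes it to a cycle.
    go th@(record { y = y ; y′ = y′ ; m = x ∷ m ; unique = unique ; fresh = fresh
                  ; inner = inner ; steps = steps }) = inj₂ record
      { D′    = D′
      ; cycle = record { long = s≤s (s≤s (1≤∷ʳ m)) ; unique = unique ; steps = λ e → classify (closing e) }
      ; uses  = uses sm
      ; steps = λ e → reroute (steps e) }
      where
      sm : Same u v y y′
      sm = ends th
      D′ = y ∷ x ∷ m ++ [ y′ ]
      1≤∷ʳ : ∀ l → 1 ≤ length (l ++ [ y′ ])
      1≤∷ʳ []      = s≤s z≤n
      1≤∷ʳ (_ ∷ _) = s≤s z≤n
      last : Consec (closeUp D′) y′ y
      last = consec-∷ʳ⁺ (y ∷ x ∷ m)
      closing : ∀ {p q} → Consec (closeUp D′) p q → Consec D′ p q ⊎ (p ≡ y′ × q ≡ y)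
      closing e = consec-∷ʳ⁻ (y ∷ x ∷ m) e
      off : ∀ {p q} → Consec D′ p q → p ≢ w × q ≢ w
      off e = (λ { refl → fresh (consec-∈ˡ e) }) , (λ { refl → fresh (consec-∈ʳ e) })
      classify : ∀ {p q} → Consec D′ p q ⊎ (p ≡ y′ × q ≡ y) → (p ≢ w × q ≢ w × R p q) ⊎ Same u v p q
      classify (inj₁ e) = inj₁ (proj₁ (off e) , proj₂ (off e) , inner e)
      classify (inj₂ (refl , refl)) = inj₂ (Sum.swap (Sum.map (λ { (a , b) → b , a }) (λ { (a , b) → b , a }) sm))
      uses : Same u v y y′ → CycleEdge D′ u v
      uses (inj₁ (refl , refl)) = inj₂ last
      uses (inj₂ (refl , refl)) = inj₁ last
      spoke : ∀ {s} → Same u v y y′ → s ≡ y ⊎ s ≡ y′ → s ≡ u ⊎ s ≡ v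
      spoke (inj₁ (refl , refl)) = id
      spoke (inj₂ (refl , refl)) = Sum.swap
      reroute : ∀ {p q} → (p ≡ w × q ≡ y) ⊎ (p ≡ y′ × q ≡ w) ⊎ Consec D′ p q →
                Same w u p q ⊎ Same w v p q ⊎ (p ≢ w × q ≢ w × Consec (closeUp D′) p q)
      reroute (inj₁ (refl , refl)) with spoke sm (inj₁ refl)
      ... | inj₁ eq = inj₁ (inj₁ (refl , eq))
      ... | inj₂ eq = inj₂ (inj₁ (inj₁ (refl , eq)))
      reroute (inj₂ (inj₁ (refl , refl))) with spoke sm (inj₂ refl)
      ... | inj₁ eq = inj₁ (inj₂ (eq , refl))
      ... | inj₂ eq = inj₂ (inj₁ (inj₂ (eq , refl)))
      reroute (inj₂ (inj₂ e)) = inj₂ (inj₂ (proj₁ (off e) , proj₂ (off e) , consec-++ˡ e))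

PathEdge : List A → A → A → Set
PathEdge l p q = Consec l p q ⊎ Consec l q p

-- The first vertex of a path has a single neighbour, so a cycle avoids it, and it can be stripped
-- off.
path-acyclic : (l : List (Fin n)) → Unique l → ∀ {D} → ¬ Cycle (PathEdge l) D
path-acyclic l u {[]} cyc with () ← Cycle.long cyc
path-acyclic [] u {_ ∷ []}    cyc = [ (λ ()) , (λ ()) ]′ (Cycle.steps cyc here)
path-acyclic [] u {_ ∷ _ ∷ _} cyc = [ (λ ()) , (λ ()) ]′ (Cycle.steps cyc here)
path-acyclic (x ∷ l) uu@(_ ∷ u) cyc =
  path-acyclic l u (cycle-off (leaf swap unique-nbr cyc) peel cyc)
  where
  x∉l : x ∉ l
  x∉l = Unique.Unique[x∷xs]⇒x∉xs uu
  unique-nbr : ∀ {q r} → PathEdge (x ∷ l) x q → PathEdge (x ∷ l) x r → q ≡ r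
  unique-nbr (inj₁ here)      (inj₁ here)      = refl
  unique-nbr (inj₁ (there e)) _                = ⊥-elim (x∉l (consec-∈ˡ e))
  unique-nbr (inj₂ here)      _                = ⊥-elim (x∉l (here refl))
  unique-nbr (inj₂ (there e)) _                = ⊥-elim (x∉l (consec-∈ʳ e))
  unique-nbr _                (inj₁ (there e)) = ⊥-elim (x∉l (consec-∈ˡ e))
  unique-nbr _                (inj₂ here)      = ⊥-elim (x∉l (here refl))
  unique-nbr _                (inj₂ (there e)) = ⊥-elim (x∉l (consec-∈ʳ e))
  peel : ∀ {p q} → p ≢ x → q ≢ x → PathEdge (x ∷ l) p q → PathEdge l p q
  peel p≢x q≢x (inj₁ here)      = ⊥-elim (p≢x refl)
  peel p≢x q≢x (inj₁ (there e)) = inj₁ e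
  peel p≢x q≢x (inj₂ here)      = ⊥-elim (q≢x refl)
  peel p≢x q≢x (inj₂ (there e)) = inj₂ e

-- Injectivity is asked on `D` only, because the lemma is also applied to `ι⁻¹`, which collapses
-- everything outside the image of `ι`.
cycle-map : {m : ℕ} {R : Rel n} {R′ : Rel m} (f : Fin n → Fin m) {D : List (Fin n)} →
            (∀ {p q} → p ∈ D → q ∈ D → f p ≡ f q → p ≡ q) → (∀ {p q} → R p q → R′ (f p) (f q)) →
            Cycle R D → Cycle R′ (map f D)
cycle-map {R = R} {R′} f {D} inj hom cyc = record
  { long   = subst (3 ≤_) (≡-sym (length-map f D)) long
  ; unique = unique-map D inj unique
  ; steps  = λ e → steps′ (consec-map⁻ f (closeUp D) (subst (λ l → Consec l _ _) (≡-sym (map-closeUp f D)) e)) }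
  where
  open Cycle cyc
  unique-map : ∀ l → (∀ {p q} → p ∈ l → q ∈ l → f p ≡ f q → p ≡ q) → Unique l → Unique (map f l)
  unique-map []      inj []       = []
  unique-map (x ∷ l) inj (≢s ∷ u) =
    All.map⁺ (All.tabulate (λ y∈l eq → All.lookup ≢s y∈l (inj (here refl) (there y∈l) eq)))
    ∷ unique-map l (λ p∈ q∈ → inj (there p∈) (there q∈)) u
  steps′ : ∀ {p q} → (∃₂ λ u v → Consec (closeUp D) u v × f u ≡ p × f v ≡ q) → R′ p q
  steps′ (_ , _ , e , refl , refl) = hom (steps e)

-- Edge lists and the number of edges of a forest

Edges : ℕ → Set
Edges n = List (Fin n × Fin n)

Adj : Edges n → Rel n
Adj L p q = (p , q) ∈ L ⊎ (q , p) ∈ L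

adj-∷⁻ : {u v p q : Fin n} {L : Edges n} → Adj ((u , v) ∷ L) p q → Same u v p q ⊎ Adj L p q
adj-∷⁻ (inj₁ (here refl)) = inj₁ (inj₁ (refl , refl))
adj-∷⁻ (inj₂ (here refl)) = inj₁ (inj₂ (refl , refl))
adj-∷⁻ (inj₁ (there i))   = inj₂ (inj₁ i)
adj-∷⁻ (inj₂ (there i))   = inj₂ (inj₂ i)

adj-here : {u v p q : Fin n} {L : Edges n} → Same u v p q → Adj ((u , v) ∷ L) p q
adj-here (inj₁ (refl , refl)) = inj₁ (here refl)
adj-here (inj₂ (refl , refl)) = inj₂ (here refl)

adj-there : {e : Fin n × Fin n} {p q : Fin n} {L : Edges n} → Adj L p q → Adj (e ∷ L) p q
adj-there = Sum.map there there

-- Repetition is excluded in both orientations, so that `length` counts undirected edges.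
Simple : Edges n → Set
Simple []            = ⊤
Simple ((u , v) ∷ L) = u ≢ v × ¬ Adj L u v × Simple L

simple⇒irreflexive : (L : Edges n) → Simple L → ∀ {p q} → Adj L p q → p ≢ q
simple⇒irreflexive []            s             (inj₁ ())
simple⇒irreflexive []            s             (inj₂ ())
simple⇒irreflexive ((u , v) ∷ L) (u≢v , _ , s) a with adj-∷⁻ a
... | inj₁ (inj₁ (refl , refl)) = u≢v
... | inj₁ (inj₂ (refl , refl)) = ≢-sym u≢v
... | inj₂ a′                   = simple⇒irreflexive L s a′

data Path {n} (R : Rel n) (b : Fin n) : Fin n → List (Fin n) → Set where
  end  : Path R b b [ b ]
  step : ∀ {p q l} → R p q → p ∉ l → Path R b q l → Path R b p (p ∷ l)

path-from : {R : Rel n} {a b p : Fin n} {l : List (Fin n)} → Path R b a l → p ∈ l → ∃ (Path R b p)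
path-from end              (here refl) = _ , end
path-from path@(step _ _ _) (here refl) = _ , path
path-from (step _ _ path)  (there i)   = path-from path i

erase-loops : {R : Rel n} {a b : Fin n} → Star R a b → ∃ (Path R b a)
erase-loops ε = _ , end
erase-loops {a = a} (r ◅ rs) with erase-loops rs
... | l , path with Any.any? (a ≟_) l
...   | yes a∈l = path-from path a∈l
...   | no  a∉l = _ , step r a∉l path

path-unique : {R : Rel n} {a b : Fin n} {l : List (Fin n)} → Path R b a l → Unique l
path-unique end               = [] ∷ []
path-unique (step _ p∉l path) = All.¬Any⇒All¬ _ p∉l ∷ path-unique path

path-close : {R : Rel n} {a b c p q : Fin n} {l : List (Fin n)} → Path R b a l →
             Consec (l ++ [ c ]) p q → R p q ⊎ (p ≡ b × q ≡ c)
path-close end                            here      = inj₂ (refl , refl)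
path-close end                            (there (there ()))
path-close (step r _ end)                 here      = inj₁ r
path-close (step r _ (step _ _ _))        here      = inj₁ r
path-close (step _ _ path)                (there e) = path-close path e

-- A simple path from `a` to `b` has at least two edges because `ab` is not in `L`, so `ab` closes
-- it to a cycle.
star⇒cycle : {L : Edges n} {a b : Fin n} → a ≢ b → ¬ Adj L a b → Star (Adj L) a b →
             ∃ (Cycle (Adj ((a , b) ∷ L)))
star⇒cycle {L = L} {a} {b} a≢b ¬ab ab with erase-loops ab
... | _ , end                            = ⊥-elim (a≢b refl)
... | _ , step r _ end                   = ⊥-elim (¬ab r)
... | _ , path@(step {l = l} _ _ (step _ _ path′)) = a ∷ l , record
  { long   = s≤s (s≤s (long path′))
  ; unique = path-unique path
  ; steps  = λ e → [ adj-there , (λ { (refl , refl) → inj₂ (here refl) }) ]′ (path-close path e) }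
  where
  long : ∀ {q l} → Path (Adj L) b q l → 1 ≤ length l
  long end          = s≤s z≤n
  long (step _ _ _) = s≤s z≤n

delete : (l : List A) {r : A} → r ∈ l →
         ∃ λ l′ → length l ≡ suc (length l′) × (∀ {x} → x ∈ l → x ≢ r → x ∈ l′)
delete l r∈l with ∈-∃++ r∈l
... | as , bs , refl = as ++ bs , length-++-sucʳ as _ bs , keep
  where
  keep : ∀ {x} → x ∈ as ++ _ ∷ bs → x ≢ _ → x ∈ as ++ bs
  keep i x≢r with ∈-++⁻ as i
  ... | inj₁ j            = ∈-++⁺ˡ j
  ... | inj₂ (here x≡r)   = ⊥-elim (x≢r x≡r)
  ... | inj₂ (there j)    = ∈-++⁺ʳ as j

-- Each vertex is connected to its representative, and each edge of a forest lowers the number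
-- of representatives by one.
record Representatives {n} (S : List (Fin n)) (L : Edges n) : Set where
  field
    reps      : List (Fin n)
    rep       : Fin n → Fin n
    count     : length reps + length L ≡ length S
    rep∈      : ∀ {p} → p ∈ S → rep p ∈ reps
    connected : ∀ p → Star (Adj L) p (rep p)

-- Union-find along the edge list: an edge between vertices with the same representative closes a
-- cycle, and any other edge merges two components.
representatives : (S : List (Fin n)) (L : Edges n) → Simple L → (∀ {p q} → Adj L p q → p ∈ S) →
                  ∃ (Cycle (Adj L)) ⊎ Representatives S L
representatives S [] _ _ = inj₂ record
  { reps = S ; rep = id ; count = ℕ.+-identityʳ _ ; rep∈ = id ; connected = λ _ → ε }
representatives S ((a , b) ∷ L) (a≢b , ¬ab , simple) L⊆S
  with representatives S L simple (λ e → L⊆S (adj-there e))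
... | inj₁ (D , cyc) = inj₁ (D , cycle-mono (λ _ _ → adj-there) cyc)
... | inj₂ r with Representatives.rep r a ≟ Representatives.rep r b
...   | yes eq = inj₁ (star⇒cycle a≢b ¬ab
          (connected a ◅◅ subst (λ c → Star (Adj L) c b) (≡-sym eq) (Star.reverse swap (connected b))))
  where open Representatives r
-- The component of `a` is absorbed by that of `b`: `rep a` leaves the list, and `rep b` takes its
-- place.
...   | no  ne = inj₂ record
  { reps      = reps′
  ; rep       = rep′
  ; count     = trans (ℕ.+-suc (length reps′) (length L)) (trans (cong (_+ length L) (≡-sym len)) count)
  ; rep∈      = λ p∈S → rep′∈ p∈S
  ; connected = connected′ }
  where
  open Representatives r
  del = delete reps (rep∈ (L⊆S (inj₁ (here refl))))
  reps′ = proj₁ del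
  len = proj₁ (proj₂ del)
  rep′ : Fin _ → Fin _
  rep′ p with rep p ≟ rep a
  ... | yes _ = rep b
  ... | no  _ = rep p
  rep′∈ : ∀ {p} → p ∈ S → rep′ p ∈ reps′
  rep′∈ {p} p∈S with rep p ≟ rep a
  ... | yes _   = proj₂ (proj₂ del) (rep∈ (L⊆S (inj₂ (here refl)))) (≢-sym ne)
  ... | no  ne′ = proj₂ (proj₂ del) (rep∈ p∈S) ne′
  lift : ∀ {p q} → Star (Adj L) p q → Star (Adj ((a , b) ∷ L)) p q
  lift = Star.map adj-there
  connected′ : ∀ p → Star (Adj ((a , b) ∷ L)) p (rep′ p)
  connected′ p with rep p ≟ rep a
  ... | yes eq = lift (connected p)
                 ◅◅ subst (λ c → Star _ c a) (≡-sym eq) (lift (Star.reverse swap (connected a)))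
                 ◅◅ inj₁ (here refl) ◅ lift (connected b)
  ... | no  _  = lift (connected p)

-- In a forest `length S - length L` representatives remain; here that leaves none, yet `s` has one.
many-edges⇒cycle : (S : List (Fin n)) (L : Edges n) → Simple L → (∀ {p q} → Adj L p q → p ∈ S) →
                   1 ≤ length S → length S ≤ length L → ∃ (Cycle (Adj L))
many-edges⇒cycle S@(s ∷ _) L simple L⊆S _ S≤L with representatives S L simple L⊆S
... | inj₁ cyc = cyc
... | inj₂ r   = ⊥-elim (no-reps reps count (rep∈ (here refl)))
  where
  open Representatives r
  no-reps : ∀ l → length l + length L ≡ length S → rep s ∉ l
  no-reps (_ ∷ l) eq _ = ℕ.<⇒≱ (s≤s (ℕ.m≤n+m (length L) (length l))) (subst (_≤ length L) (≡-sym eq) S≤L)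

-- Pigeonhole: if both colour classes had fewer than `length S` edges, then `length L + 2` would be
-- at most `length S + length S`, which is `length L + 1`.
two-colouring⇒cycle : (S : List (Fin n)) (L : Edges n) → Simple L → (∀ {p q} → Adj L p q → p ∈ S) →
                      length S + length S ≡ suc (length L) → ((c , _) : SymColouring n) →
                      ∃₂ λ b D → Cycle (λ p q → Adj L p q × c p q ≡ b) D
two-colouring⇒cycle {n} S L simple L⊆S count (c , c-sym) =
  majority (length S ℕ.≤? length (class true L)) (length S ℕ.≤? length (class false L))
  where
  coloured? : ∀ b (e : Fin n × Fin n) → Dec (c (proj₁ e) (proj₂ e) ≡ b)
  coloured? b e = c (proj₁ e) (proj₂ e) Bool.≟ b

  class : Bool → Edges n → Edges n
  class b = filter (coloured? b)

  class-adj : ∀ b L {p q} → Adj (class b L) p q → Adj L p q × c p q ≡ b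
  class-adj b L (inj₁ i) = let j , eq = ∈-filter⁻ (coloured? b) {xs = L} i in inj₁ j , eq
  class-adj b L (inj₂ i) = let j , eq = ∈-filter⁻ (coloured? b) {xs = L} i in inj₂ j , trans (c-sym _ _) eq

  class-simple : ∀ b L → Simple L → Simple (class b L)
  class-simple b [] _ = tt
  class-simple b ((u , v) ∷ L) (u≢v , ¬uv , s) with does (coloured? b (u , v))
  ... | false = class-simple b L s
  ... | true  = u≢v , (λ a → ¬uv (proj₁ (class-adj b L a))) , class-simple b L s

  class-length : ∀ L → length (class true L) + length (class false L) ≡ length L
  class-length [] = refl
  class-length ((p , q) ∷ L) with c p q
  ... | true  = cong suc (class-length L)
  ... | false = trans (ℕ.+-suc _ _) (cong suc (class-length L))

  1≤S : ∀ S → length S + length S ≡ suc (length L) → 1 ≤ length S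
  1≤S (_ ∷ _) _ = s≤s z≤n

  large : ∀ b → length S ≤ length (class b L) → ∃₂ λ b D → Cycle (λ p q → Adj L p q × c p q ≡ b) D
  large b le =
    let D , cyc = many-edges⇒cycle S (class b L) (class-simple b L simple)
                    (λ a → L⊆S (proj₁ (class-adj b L a))) (1≤S S count) le
    in b , D , cycle-mono (λ _ _ → class-adj b L) cyc

  majority : Dec (length S ≤ length (class true L)) → Dec (length S ≤ length (class false L)) →
             ∃₂ λ b D → Cycle (λ p q → Adj L p q × c p q ≡ b) D
  majority (yes le) _        = large true le
  majority (no _)   (yes le) = large false le
  majority (no lt₁) (no lt₂) = ⊥-elim (ℕ.<-irrefl (class-length L) (ℕ.≤-pred
    (subst (suc (suc (length (class true L) + length (class false L))) ≤_) count
      (subst (_≤ length S + length S) (cong suc (ℕ.+-suc _ _))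
        (ℕ.+-mono-≤ (ℕ.≰⇒> lt₁) (ℕ.≰⇒> lt₂))))))

same-swap : {u v : Fin n} → Symmetric (Same u v)
same-swap = Sum.swap ∘ Sum.map (λ (a , b) → b , a) (λ (a , b) → b , a)

same-flip : {u v p q : Fin n} → Same u v p q → Same v u p q
same-flip = Sum.swap

adj-sym : {L : Edges n} → Symmetric (Adj L)
adj-sym = swap

-- Colourings

Class : Rel n → SymColouring n → Bool → Rel n
Class R c b p q = R p q × col c p q ≡ b

class-sym : {R : Rel n} {c : SymColouring n} {b : Bool} → Symmetric R → Symmetric (Class R c b)
class-sym {c = c} R-sym (r , eq) = R-sym r , trans (proj₂ c _ _) eq

infix 4 _⊑_

-- When `D` and `C` are both cycles, this forces equal edge sets, since no cycle lives on a proper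
-- part of the edges of another. Inclusion avoids comparing lists up to rotation and reversal.
_⊑_ : List (Fin n) → List (Fin n) → Set
D ⊑ C = ∀ {p q} → Consec (closeUp D) p q → CycleEdge C p q

OnCycle : List (List (Fin n)) → Rel n
OnCycle Cs p q = Any (λ C → CycleEdge C p q) Cs

onCycle-sym : {Cs : List (List (Fin n))} → Symmetric (OnCycle Cs)
onCycle-sym = Any.map swap

-- With `Cs = []` no monochromatic cycle is allowed at all; this case expresses that the graph is a
-- union of two forests.
Good : Rel n → SymColouring n → List (List (Fin n)) → Set
Good R c Cs = ∀ {b D} → Cycle (Class R c b) D → Any (D ⊑_) Cs

⊑-onCycle : {Cs : List (List (Fin n))} {D : List (Fin n)} {p q : Fin n} →
            Any (D ⊑_) Cs → CycleEdge D p q → OnCycle Cs p q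
⊑-onCycle D⊑ (inj₁ e) = Any.map (λ D⊑C → D⊑C e) D⊑
⊑-onCycle D⊑ (inj₂ e) = Any.map (λ D⊑C → swap (D⊑C e)) D⊑

recolour : Fin n → (Fin n → Bool) → SymColouring n → SymColouring n
recolour {n} w g (c , c-sym) = c′ , c′-sym
  where
  c′ : Fin n → Fin n → Bool
  c′ p q with p ≟ w | q ≟ w
  ... | yes _ | _     = g q
  ... | no _  | yes _ = g p
  ... | no _  | no _  = c p q
  c′-sym : ∀ p q → c′ p q ≡ c′ q p
  c′-sym p q with p ≟ w | q ≟ w
  ... | yes refl | yes refl = refl
  ... | yes _    | no _     = refl
  ... | no _     | yes _    = refl
  ... | no _     | no _     = c-sym p q

recolour-at : (w : Fin n) (g : Fin n → Bool) (c : SymColouring n) (q : Fin n) → col (recolour w g c) w q ≡ g q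
recolour-at w g c q with w ≟ w | q ≟ w
... | yes _ | _ = refl
... | no ne | _ = ⊥-elim (ne refl)

recolour-off : (w : Fin n) (g : Fin n → Bool) (c : SymColouring n) {p q : Fin n} → p ≢ w → q ≢ w →
               col (recolour w g c) p q ≡ col c p q
recolour-off w g c {p} {q} p≢w q≢w with p ≟ w | q ≟ w
... | yes eq | _      = ⊥-elim (p≢w eq)
... | no _   | yes eq = ⊥-elim (q≢w eq)
... | no _   | no _   = refl

exceptAt : Fin n → Bool → Fin n → Bool
exceptAt z b s = if does (s ≟ z) then not b else b

exceptAt-≢ : {z s : Fin n} {b : Bool} → s ≢ z → exceptAt z b s ≡ b
exceptAt-≢ {z = z} {s} ne with s ≟ z
... | yes eq = ⊥-elim (ne eq)
... | no _   = refl

exceptAt-≡ : (z : Fin n) {b : Bool} → exceptAt z b z ≡ not b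
exceptAt-≡ z with z ≟ z
... | yes _ = refl
... | no ne = ⊥-elim (ne refl)

exceptAt-injective : {z s : Fin n} {b : Bool} → s ≢ z → exceptAt z b z ≢ exceptAt z b s
exceptAt-injective {z = z} {b = b} ne eq =
  Bool.not-¬ refl (trans (≡-sym (exceptAt-≢ {b = b} ne)) (trans (≡-sym eq) (exceptAt-≡ z)))

module _ {R R′ : Rel n} {w : Fin n} (R′-sym : Symmetric R′)
         (off : ∀ {p q} → p ≢ w → q ≢ w → R′ p q → R p q) where

  -- The edges at `w` all get different colours, so `w` is at most a leaf in each class and no
  -- monochromatic cycle meets it.
  good-attach : {g : Fin n → Bool} (c : SymColouring n) {Cs : List (List (Fin n))} →
                (∀ {q r} → R′ w q → R′ w r → g q ≡ g r → q ≡ r) →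
                Good R c Cs → Good R′ (recolour w g c) Cs
  good-attach {g} c ≤1 good {b} {D} cyc = good (cycle-off w∉D off′ cyc)
    where
    w∉D : w ∉ D
    w∉D = leaf (class-sym {R = R′} {c = recolour w g c} {b} R′-sym)
      (λ {q} {r} (a , eq) (a′ , eq′) →
        ≤1 a a′ (trans (≡-sym (recolour-at w g c q)) (trans (trans eq (≡-sym eq′)) (recolour-at w g c r)))) cyc
    off′ : ∀ {p q} → p ≢ w → q ≢ w → Class R′ (recolour w g c) b p q → Class R c b p q
    off′ p≢w q≢w (r , eq) = off p≢w q≢w r , trans (≡-sym (recolour-off w g c p≢w q≢w)) eq

-- R′ arises from R by replacing the edge uv by the path u w v, which inherits the colour of uv,
-- and joining w to z by an edge of the other colour.
module Subdivision
  {R R′ : Rel n} {u v w z : Fin n} (R-sym : Symmetric R) (R′-sym : Symmetric R′) (uv : R u v)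
  (u≢w : u ≢ w) (v≢w : v ≢ w) (u≢z : u ≢ z) (v≢z : v ≢ z)
  (nbr : ∀ {q} → R′ w q → q ≡ u ⊎ q ≡ v ⊎ q ≡ z)
  (off : ∀ {p q} → p ≢ w → q ≢ w → R′ p q → R p q × ¬ Same u v p q)
  (c : SymColouring n) where

  b₀ : Bool
  b₀ = col c u v

  c′ : SymColouring n
  c′ = recolour w (exceptAt z b₀) c

  -- The two possible origins of a monochromatic cycle of `R′`: it is a cycle of `R` not using `uv`,
  -- or it subdivides a cycle `D′` of `R` that uses `uv`.
  Outcome : Bool → List (Fin n) → Set
  Outcome b D =
    Cycle (λ p q → Class R c b p q × ¬ Same u v p q) D
    ⊎ (∃ λ D′ → Cycle (Class R c b) D′ × CycleEdge D′ u v ×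
        (∀ {p q} → Consec (closeUp D) p q →
          Same w u p q ⊎ Same w v p q ⊎ (¬ Same u v p q × Consec (closeUp D′) p q)))

  outcome : ∀ {b D} → Cycle (Class R′ c′ b) D → Outcome b D
  outcome {b} {D} cyc with Any.any? (w ≟_) D | b Bool.≟ b₀
  ... | no w∉D | _ = inj₁ (cycle-off w∉D off′ cyc)
    where
    off′ : ∀ {p q} → p ≢ w → q ≢ w → Class R′ c′ b p q → Class R c b p q × ¬ Same u v p q
    off′ p≢w q≢w (r , eq) =
      (proj₁ (off p≢w q≢w r) , trans (≡-sym (recolour-off w (exceptAt z b₀) c p≢w q≢w)) eq) , proj₂ (off p≢w q≢w r)
  -- Only `wz` can have a colour other than `b₀`, so `w` is at most a leaf in this class.
  ... | yes w∈D | no b≢b₀ = ⊥-elim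
    (leaf (class-sym {R = R′} {c = c′} {b} R′-sym) (λ r s → trans (only-z r) (≡-sym (only-z s))) cyc w∈D)
    where
    only-z : ∀ {q} → Class R′ c′ b w q → q ≡ z
    only-z {q} (r , eq) with nbr r
    ... | inj₁ refl        = ⊥-elim (b≢b₀ (trans (≡-sym eq) (trans (recolour-at w _ c u) (exceptAt-≢ u≢z))))
    ... | inj₂ (inj₁ refl) = ⊥-elim (b≢b₀ (trans (≡-sym eq) (trans (recolour-at w _ c v) (exceptAt-≢ v≢z))))
    ... | inj₂ (inj₂ eq′)  = eq′
  ... | yes w∈D | yes refl = result (shortcut (class-sym {R = R′} {c = c′} {b₀} R′-sym) nbr′ cyc w∈D)
    where
    nbr′ : ∀ {q} → Class R′ c′ b₀ w q → q ≡ u ⊎ q ≡ v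
    nbr′ (r , eq) with nbr r
    ... | inj₁ eq′         = inj₁ eq′
    ... | inj₂ (inj₁ eq′)  = inj₂ eq′
    ... | inj₂ (inj₂ refl) = ⊥-elim (Bool.not-¬ refl (trans (≡-sym eq) (trans (recolour-at w _ c z) (exceptAt-≡ z))))
    result : (Class R′ c′ b₀ u v × _) ⊎ Shortcut (Class R′ c′ b₀) w u v D → Outcome b₀ D
    -- The triangle `w u v` would need the edge `uv`, which `R′` has lost.
    result (inj₁ ((r , _) , _)) = ⊥-elim (proj₂ (off u≢w v≢w r) (inj₁ (refl , refl)))
    result (inj₂ s) = inj₂ (D′ , cycle-mono (λ _ _ → embed) cycle , uses , λ e → classify e (steps e))
      where
      open Shortcut s
      embed : ∀ {p q} → (p ≢ w × q ≢ w × Class R′ c′ b₀ p q) ⊎ Same u v p q → Class R c b₀ p q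
      embed (inj₁ (p≢w , q≢w , r , eq)) =
        proj₁ (off p≢w q≢w r) , trans (≡-sym (recolour-off w (exceptAt z b₀) c p≢w q≢w)) eq
      embed (inj₂ (inj₁ (refl , refl))) = uv , refl
      embed (inj₂ (inj₂ (refl , refl))) = R-sym uv , proj₂ c v u
      classify : ∀ {p q} → Consec (closeUp D) p q →
                 Same w u p q ⊎ Same w v p q ⊎ (p ≢ w × q ≢ w × Consec (closeUp D′) p q) →
                 Same w u p q ⊎ Same w v p q ⊎ (¬ Same u v p q × Consec (closeUp D′) p q)
      classify e = Sum.map₂ (Sum.map₂ λ (p≢w , q≢w , e′) →
        proj₂ (off p≢w q≢w (proj₁ (Cycle.steps cyc e))) , e′)

  -- A subdivided cycle comes from a monochromatic cycle through `uv`; that one lies in a member of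
  -- `Cs`, and no member contains `uv`.
  good-subdivide : {Cs : List (List (Fin n))} → ¬ OnCycle Cs u v → Good R c Cs → Good R′ c′ Cs
  good-subdivide ¬uv good cyc with outcome cyc
  ... | inj₁ cyc₀                = good (cycle-mono (λ _ _ → proj₁) cyc₀)
  ... | inj₂ (_ , cyc₀ , uv∈ , _) = ⊥-elim (¬uv (⊑-onCycle (good cyc₀) uv∈))

module _ {h x : Fin n} (t : List (Fin n)) where

  closing-edge : CycleEdge (h ∷ t ++ [ x ]) h x
  closing-edge = inj₂ (consec-∷ʳ⁺ (h ∷ t))

  open-cycle : ∀ {p q} → CycleEdge (h ∷ t ++ [ x ]) p q → ¬ Same h x p q → PathEdge (h ∷ t ++ [ x ]) p q
  open-cycle (inj₁ e) ¬hx = inj₁ ([ id , (λ eq → ⊥-elim (¬hx (inj₂ eq))) ]′ (consec-∷ʳ⁻ (h ∷ t) e))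
  open-cycle (inj₂ e) ¬hx = inj₂ ([ id , (λ (a , b) → ⊥-elim (¬hx (inj₁ (b , a)))) ]′ (consec-∷ʳ⁻ (h ∷ t) e))

  pathEdge⇒cycleEdge : ∀ {w p q} → PathEdge (h ∷ t ++ [ x ]) p q → CycleEdge (w ∷ h ∷ t ++ [ x ]) p q
  pathEdge⇒cycleEdge = Sum.map (there ∘ consec-++ˡ) (there ∘ consec-++ˡ)

  cycleEdge-∷⁻ : ∀ {w p q} → CycleEdge (w ∷ h ∷ t ++ [ x ]) p q →
                 Same w h p q ⊎ Same w x p q ⊎ PathEdge (h ∷ t ++ [ x ]) p q
  cycleEdge-∷⁻ {w} (inj₁ e) with consec-∷ʳ⁻ (w ∷ h ∷ t) e
  ... | inj₁ here      = inj₁ (inj₁ (refl , refl))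
  ... | inj₁ (there e) = inj₂ (inj₂ (inj₁ e))
  ... | inj₂ eq        = inj₂ (inj₁ (inj₂ eq))
  cycleEdge-∷⁻ {w} (inj₂ e) with consec-∷ʳ⁻ (w ∷ h ∷ t) e
  ... | inj₁ here      = inj₁ (inj₂ (refl , refl))
  ... | inj₁ (there e) = inj₂ (inj₂ (inj₂ e))
  ... | inj₂ (a , b)   = inj₂ (inj₁ (inj₁ (b , a)))

  cycleEdge-new₁ : ∀ {w p q} → Same w h p q → CycleEdge (w ∷ h ∷ t ++ [ x ]) p q
  cycleEdge-new₁ (inj₁ (refl , refl)) = inj₁ here
  cycleEdge-new₁ (inj₂ (refl , refl)) = inj₂ here

  cycleEdge-new₂ : ∀ {w p q} → Same w x p q → CycleEdge (w ∷ h ∷ t ++ [ x ]) p q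
  cycleEdge-new₂ {w} (inj₁ (refl , refl)) = inj₂ (consec-∷ʳ⁺ (w ∷ h ∷ t))
  cycleEdge-new₂ {w} (inj₂ (refl , refl)) = inj₁ (consec-∷ʳ⁺ (w ∷ h ∷ t))

module SubdivideCycle
  {R R′ : Rel n} {h x w z : Fin n} (R-sym : Symmetric R) (R′-sym : Symmetric R′) (hx : R h x)
  (h≢w : h ≢ w) (x≢w : x ≢ w) (h≢z : h ≢ z) (x≢z : x ≢ z)
  (nbr : ∀ {q} → R′ w q → q ≡ h ⊎ q ≡ x ⊎ q ≡ z)
  (off : ∀ {p q} → p ≢ w → q ≢ w → R′ p q → R p q × ¬ Same h x p q)
  (c : SymColouring n) where

  open Subdivision R-sym R′-sym hx h≢w x≢w h≢z x≢z nbr off c public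

  -- Without `hx` the old cycle is a path, so a monochromatic cycle avoiding `hx` lies in one of the
  -- other cycles. One that uses `hx` lies in the old cycle, the only one containing `hx`, and its
  -- subdivision lies in the new cycle.
  good-lengthen : (t : List (Fin n)) {Cs : List (List (Fin n))} → Unique (h ∷ t ++ [ x ]) →
                  ¬ OnCycle Cs h x → Good R c ((h ∷ t ++ [ x ]) ∷ Cs) →
                  Good R′ c′ ((w ∷ h ∷ t ++ [ x ]) ∷ Cs)
  good-lengthen t u ¬hx good cyc with outcome cyc
  good-lengthen t u ¬hx good cyc | inj₁ cyc₀ with good (cycle-mono (λ _ _ → proj₁) cyc₀)
  ... | there D⊑ = there D⊑
  ... | here D⊑C = ⊥-elim (path-acyclic _ u record
    { Cycle cyc₀ hiding (steps)
    ; steps = λ e → open-cycle t (D⊑C e) (proj₂ (Cycle.steps cyc₀ e)) })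
  good-lengthen t u ¬hx good {D = D} cyc | inj₂ (D′ , cyc₀ , hx∈ , steps) with good cyc₀
  ... | there D⊑ = ⊥-elim (¬hx (⊑-onCycle D⊑ hx∈))
  ... | here D′⊑C = here (λ e → embed (steps e))
    where
    embed : ∀ {p q} → Same w h p q ⊎ Same w x p q ⊎ (¬ Same h x p q × Consec (closeUp D′) p q) →
            CycleEdge (w ∷ h ∷ t ++ [ x ]) p q
    embed (inj₁ eq)               = cycleEdge-new₁ t eq
    embed (inj₂ (inj₁ eq))        = cycleEdge-new₂ t eq
    embed (inj₂ (inj₂ (¬hx , e))) = pathEdge⇒cycleEdge t (open-cycle t (D′⊑C e) ¬hx)

-- Edge-critical graphs with twice as many edges as vertices, less one

infixl 6 _∖_

_∖_ : Rel n → Fin n × Fin n → Rel n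
(R ∖ (u , v)) p q = R p q × ¬ Same u v p q

same-sym : {u v p q : Fin n} → Same u v p q → Same p q u v
same-sym (inj₁ (refl , refl)) = inj₁ (refl , refl)
same-sym (inj₂ (refl , refl)) = inj₂ (refl , refl)

∖-sym : {R : Rel n} {e : Fin n × Fin n} → Symmetric R → Symmetric (R ∖ e)
∖-sym R-sym (r , ¬e) = R-sym r , ¬e ∘ same-swap

-- `S` lists the vertices in use within a fixed `Fin n`, so the graph grows without changing its
-- type. `covered` later turns a vertex missed by a subgraph into a missed edge.
record Core {n} (S : List (Fin n)) (L : Edges n) : Set where
  field
    count    : length S + length S ≡ suc (length L)
    simple   : Simple L
    closed   : ∀ {p q} → Adj L p q → p ∈ S
    covered  : ∀ {p} → p ∈ S → ∃ (Adj L p)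
    critical : ∀ {p q} → Adj L p q → ∃ λ c → Good (Adj L ∖ (p , q)) c []

  irreflexive : ∀ {p q} → Adj L p q → p ≢ q
  irreflexive = simple⇒irreflexive L simple

record Removal {n} (L : Edges n) (u v : Fin n) : Set where
  field
    remaining : Edges n
    size      : length L ≡ suc (length remaining)
    split     : ∀ {p q} → Adj L p q → Same u v p q ⊎ Adj remaining p q
    keep      : ∀ {p q} → Adj remaining p q → Adj L p q
    absent    : ¬ Adj remaining u v
    simple    : Simple remaining

  without : ∀ {p q} → Adj remaining p q → (Adj L ∖ (u , v)) p q
  without a = keep a , λ { (inj₁ (refl , refl)) → absent a ; (inj₂ (refl , refl)) → absent (swap a) }

remove : (L : Edges n) {u v : Fin n} → Simple L → Adj L u v → Removal L u v
remove []            s (inj₁ ())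
remove []            s (inj₂ ())
remove ((a , b) ∷ L) {u} {v} (a≢b , ¬ab , s) uv with adj-∷⁻ uv
... | inj₁ eq = record
  { remaining = L ; size = refl ; simple = s
  ; split  = λ e → Sum.map₁ (same-trans eq) (adj-∷⁻ e)
  ; keep   = adj-there
  ; absent = absent eq }
  where
  same-trans : Same a b u v → ∀ {p q} → Same a b p q → Same u v p q
  same-trans (inj₁ (refl , refl)) = id
  same-trans (inj₂ (refl , refl)) = same-flip
  absent : Same a b u v → ¬ Adj L u v
  absent (inj₁ (refl , refl)) = ¬ab
  absent (inj₂ (refl , refl)) = ¬ab ∘ swap
... | inj₂ uv′ = record
  { remaining = (a , b) ∷ remaining ; size = cong suc size
  ; simple = a≢b , (λ e → ¬ab (keep e)) , simple
  ; split  = λ e → [ (λ eq → inj₂ (adj-here eq)) , (λ e′ → Sum.map₂ adj-there (split e′)) ]′ (adj-∷⁻ e)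
  ; keep   = λ e → [ adj-here , (λ e′ → adj-there (keep e′)) ]′ (adj-∷⁻ e)
  ; absent = λ e → [ new , absent ]′ (adj-∷⁻ e) }
  where
  open Removal (remove L s uv′)
  new : ¬ Same a b u v
  new (inj₁ (refl , refl)) = ¬ab uv′
  new (inj₂ (refl , refl)) = ¬ab (swap uv′)

exceptAt-separates : {a z q r : Fin n} {b : Bool} → a ≢ z → q ≡ a ⊎ q ≡ z → r ≡ a ⊎ r ≡ z →
                     exceptAt z b q ≡ exceptAt z b r → q ≡ r
exceptAt-separates a≢z (inj₁ refl) (inj₁ refl) _  = refl
exceptAt-separates {b = b} a≢z (inj₁ refl) (inj₂ refl) eq = ⊥-elim (exceptAt-injective {b = b} a≢z (≡-sym eq))
exceptAt-separates {b = b} a≢z (inj₂ refl) (inj₁ refl) eq = ⊥-elim (exceptAt-injective {b = b} a≢z eq)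
exceptAt-separates a≢z (inj₂ refl) (inj₂ refl) _  = refl

module Fork {S : List (Fin n)} {L : Edges n} (core : Core S L) {u v w z : Fin n}
            (uv : Adj L u v) (w∉S : w ∉ S) (z∈S : z ∈ S) (z≢u : z ≢ u) (z≢v : z ≢ v) where

  open Core core
  private
    rem : Removal L u v
    rem = remove L simple uv
  open Removal rem using (remaining; size; split; without) renaming (simple to simple₀)

  L′ : Edges n
  L′ = (u , w) ∷ (w , v) ∷ (w , z) ∷ remaining

  ∈S⇒≢w : ∀ {p} → p ∈ S → p ≢ w
  ∈S⇒≢w p∈S refl = w∉S p∈S

  u≢v : u ≢ v
  u≢v = irreflexive uv
  u≢w : u ≢ w
  u≢w = ∈S⇒≢w (closed uv)
  v≢w : v ≢ w
  v≢w = ∈S⇒≢w (closed (swap uv))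
  z≢w : z ≢ w
  z≢w = ∈S⇒≢w z∈S

  private
    isolated : ∀ {q} → ¬ Adj remaining w q
    isolated e = w∉S (closed (proj₁ (without e)))

    cases : ∀ {p q} → Adj L′ p q → Same w u p q ⊎ Same w v p q ⊎ Same w z p q ⊎ Adj remaining p q
    cases = Sum.map same-flip (Sum.map₂ adj-∷⁻ ∘ adj-∷⁻) ∘ adj-∷⁻

  nbr : ∀ {q} → Adj L′ w q → q ≡ u ⊎ q ≡ v ⊎ q ≡ z
  nbr e with cases e
  ... | inj₁ (inj₁ (_ , eq))               = inj₁ eq
  ... | inj₁ (inj₂ (eq , _))               = ⊥-elim (u≢w (≡-sym eq))
  ... | inj₂ (inj₁ (inj₁ (_ , eq)))        = inj₂ (inj₁ eq)
  ... | inj₂ (inj₁ (inj₂ (eq , _)))        = ⊥-elim (v≢w (≡-sym eq))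
  ... | inj₂ (inj₂ (inj₁ (inj₁ (_ , eq)))) = inj₂ (inj₂ eq)
  ... | inj₂ (inj₂ (inj₁ (inj₂ (eq , _)))) = ⊥-elim (z≢w (≡-sym eq))
  ... | inj₂ (inj₂ (inj₂ e′))              = ⊥-elim (isolated e′)

  off : ∀ {p q} → p ≢ w → q ≢ w → Adj L′ p q → (Adj L ∖ (u , v)) p q
  off p≢w q≢w e with cases e
  ... | inj₁ (inj₁ (eq , _))               = ⊥-elim (p≢w eq)
  ... | inj₁ (inj₂ (_ , eq))               = ⊥-elim (q≢w eq)
  ... | inj₂ (inj₁ (inj₁ (eq , _)))        = ⊥-elim (p≢w eq)
  ... | inj₂ (inj₁ (inj₂ (_ , eq)))        = ⊥-elim (q≢w eq)
  ... | inj₂ (inj₂ (inj₁ (inj₁ (eq , _)))) = ⊥-elim (p≢w eq)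
  ... | inj₂ (inj₂ (inj₁ (inj₂ (_ , eq)))) = ⊥-elim (q≢w eq)
  ... | inj₂ (inj₂ (inj₂ e′))              = without e′

  kept : ∀ {p q} → (Adj L ∖ (u , v)) p q → Adj L′ p q
  kept (e , ¬uv) = [ ⊥-elim ∘ ¬uv , adj-there ∘ adj-there ∘ adj-there ]′ (split e)

  wu : Adj L′ w u
  wu = inj₂ (here refl)
  wv : Adj L′ w v
  wv = inj₁ (there (here refl))
  wz : Adj L′ w z
  wz = inj₁ (there (there (here refl)))

  -- Three edges replace one, so twice the number of vertices and the number of edges both rise by
  -- two. If an edge at `w` is deleted, the colouring that shows `uv` critical extends: the two
  -- edges left at `w` get different colours.
  fork : Core (w ∷ S) L′
  fork = record
    { count    = cong suc (trans (ℕ.+-suc _ _) (cong suc (trans count (cong suc size))))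
    ; simple   = u≢w , (λ e → [ (λ { (inj₁ (eq , _)) → u≢w eq ; (inj₂ (eq , _)) → u≢v eq })
                              , (λ e → [ (λ { (inj₁ (eq , _)) → u≢w eq ; (inj₂ (eq , _)) → z≢u (≡-sym eq) })
                                       , isolated ∘ swap ]′ (adj-∷⁻ e)) ]′ (adj-∷⁻ e))
               , ≢-sym v≢w , (λ e → [ (λ { (inj₁ (_ , eq)) → z≢v (≡-sym eq) ; (inj₂ (eq , _)) → z≢w (≡-sym eq) })
                                    , isolated ]′ (adj-∷⁻ e))
               , ≢-sym z≢w , isolated , simple₀
    ; closed   = closed′
    ; covered  = covered′
    ; critical = λ e → critical′ e (cases e) }
    where
    closed′ : ∀ {p q} → Adj L′ p q → p ∈ w ∷ S
    closed′ e with cases e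
    ... | inj₁ (inj₁ (refl , _))               = here refl
    ... | inj₁ (inj₂ (refl , _))               = there (closed uv)
    ... | inj₂ (inj₁ (inj₁ (refl , _)))        = here refl
    ... | inj₂ (inj₁ (inj₂ (refl , _)))        = there (closed (swap uv))
    ... | inj₂ (inj₂ (inj₁ (inj₁ (refl , _)))) = here refl
    ... | inj₂ (inj₂ (inj₁ (inj₂ (refl , _)))) = there z∈S
    ... | inj₂ (inj₂ (inj₂ e′))                = there (closed (proj₁ (without e′)))
    covered′ : ∀ {p} → p ∈ w ∷ S → ∃ (Adj L′ p)
    covered′ (here refl) = u , wu
    covered′ {p} (there p∈S) with covered p∈S
    ... | q , pq with split pq
    ...   | inj₁ (inj₁ (refl , refl)) = w , swap wu
    ...   | inj₁ (inj₂ (refl , refl)) = w , swap wv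
    ...   | inj₂ e = q , adj-there (adj-there (adj-there e))
    at-w : ∀ {p q a t} → a ≢ t → (∀ {r} → (Adj L′ ∖ (p , q)) w r → r ≡ a ⊎ r ≡ t) →
           ∃ λ c → Good (Adj L′ ∖ (p , q)) c []
    at-w {p} {q} {a} {t} a≢t nbr′ =
      let c , good = critical uv
      in recolour w (exceptAt t true) c ,
         good-attach {R = Adj L ∖ (u , v)} (∖-sym {R = Adj L′} (adj-sym {L = L′}))
           (λ p≢w q≢w (e , _) → off p≢w q≢w e) c
           (λ e e′ → exceptAt-separates {b = true} a≢t (nbr′ e) (nbr′ e′)) good
    critical′ : ∀ {p q} → Adj L′ p q → Same w u p q ⊎ Same w v p q ⊎ Same w z p q ⊎ Adj remaining p q →
                ∃ λ c → Good (Adj L′ ∖ (p , q)) c []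
    critical′ _ (inj₁ eq) = at-w (≢-sym z≢v) λ (e , ne) →
      [ (λ { refl → ⊥-elim (ne (same-sym eq)) }) , id ]′ (nbr e)
    critical′ _ (inj₂ (inj₁ eq)) = at-w (≢-sym z≢u) λ (e , ne) →
      [ inj₁ , [ (λ { refl → ⊥-elim (ne (same-sym eq)) }) , inj₂ ]′ ]′ (nbr e)
    critical′ _ (inj₂ (inj₂ (inj₁ eq))) = at-w u≢v λ (e , ne) →
      [ inj₁ , [ inj₂ , (λ { refl → ⊥-elim (ne (same-sym eq)) }) ]′ ]′ (nbr e)
    -- The deleted edge `pq` is not `uv`, so `uv` is still there to be subdivided in the graph
    -- without `pq`.
    critical′ {p} {q} _ (inj₂ (inj₂ (inj₂ e))) =
      let pq , ¬uv = without e
          c , good = critical pq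
      in recolour w (exceptAt z (col c u v)) c ,
         Subdivision.good-subdivide {R = Adj L ∖ (p , q)} {R′ = Adj L′ ∖ (p , q)}
               (∖-sym {R = Adj L} (adj-sym {L = L})) (∖-sym {R = Adj L′} (adj-sym {L = L′}))
               (uv , ¬uv ∘ same-sym) u≢w v≢w (≢-sym z≢u) (≢-sym z≢v) (nbr ∘ proj₁)
               (λ p≢w q≢w (e , ne) → let e′ , ne′ = off p≢w q≢w e in (e′ , ne) , ne′) c (λ ()) good

-- Critical graphs containing a family of cycles

Palette : List (List (Fin n)) → Set
Palette = All (λ _ → Bool)

Paints : SymColouring n → (Cs : List (List (Fin n))) → Palette Cs → Set
Paints c []       []      = ⊤
Paints c (C ∷ Cs) (b ∷ β) = (∀ {p q} → CycleEdge C p q → col c p q ≡ b) × Paints c Cs β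

paints-cong : {c c′ : SymColouring n} (Cs : List (List (Fin n))) {β : Palette Cs} →
              (∀ {p q} → OnCycle Cs p q → col c′ p q ≡ col c p q) → Paints c Cs β → Paints c′ Cs β
paints-cong []       {[]}    _ _          = tt
paints-cong {c = c} {c′} (C ∷ Cs) {b ∷ β} f (eq , ps) =
  (λ e → trans (f (here e)) (eq e)) , paints-cong {c = c} {c′} Cs (f ∘ there) ps

record FreeEdge {n} (L : Edges n) (Cs : List (List (Fin n))) (u v : Fin n) : Set where
  constructor free
  field
    edge : Adj L u v
    ¬on  : ¬ OnCycle Cs u v

record DisjointFreeEdges {n} (L : Edges n) (Cs : List (List (Fin n))) : Set where
  field
    u v u′ v′ : Fin n
    first     : FreeEdge L Cs u v
    second    : FreeEdge L Cs u′ v′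
    u≢u′      : u ≢ u′
    u≢v′      : u ≢ v′
    v≢u′      : v ≢ u′
    v≢v′      : v ≢ v′

  avoiding : ∀ x → ∃₂ λ p q → FreeEdge L Cs p q × p ≢ x × q ≢ x
  avoiding x with x ≟ u | x ≟ v
  ... | yes refl | _        = u′ , v′ , second , ≢-sym u≢u′ , ≢-sym u≢v′
  ... | no _     | yes refl = u′ , v′ , second , ≢-sym v≢u′ , ≢-sym v≢v′
  ... | no x≢u   | no x≢v   = u , v , first , ≢-sym x≢u , ≢-sym x≢v

-- `paint` is the extension property, indexed by the colours chosen for the cycles. `spare` provides
-- edges that can be replaced without touching a cycle.
record Config {n} (S : List (Fin n)) (L : Edges n) (Cs : List (List (Fin n))) : Set where
  field
    core      : Core S L
    contained : ∀ {p q} → OnCycle Cs p q → Adj L p q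
    spare     : DisjointFreeEdges L Cs
    paint     : (β : Palette Cs) → ∃ λ c → Paints c Cs β × Good (Adj L) c Cs

  open Core core public

  onCycle⇒∈S : ∀ {p q} → OnCycle Cs p q → p ∈ S
  onCycle⇒∈S = closed ∘ contained

module _ {S : List (Fin n)} {L : Edges n} where

  -- Lengthening works on a cycle listed with a prescribed last vertex; this passes from that
  -- listing back to the cycle as given.
  config-cong : {C C′ : List (Fin n)} {Cs : List (List (Fin n))} →
                (∀ {p q} → CycleEdge C p q → CycleEdge C′ p q) → (∀ {p q} → CycleEdge C′ p q → CycleEdge C p q) →
                Config S L (C ∷ Cs) → Config S L (C′ ∷ Cs)
  config-cong {C} {C′} {Cs} to from K = record
    { core = core ; contained = contained ∘ back
    ; spare = record { DisjointFreeEdges spare hiding (first; second; avoiding)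
                     ; first = relax (DisjointFreeEdges.first spare)
                     ; second = relax (DisjointFreeEdges.second spare) }
    ; paint = paint′ }
    where
    open Config K
    back : ∀ {p q} → OnCycle (C′ ∷ Cs) p q → OnCycle (C ∷ Cs) p q
    back (here e)  = here (from e)
    back (there o) = there o
    relax : ∀ {u v} → FreeEdge L (C ∷ Cs) u v → FreeEdge L (C′ ∷ Cs) u v
    relax (free e ¬o) = free e (¬o ∘ back)
    paint′ : (β : Palette (C′ ∷ Cs)) → ∃ λ c → Paints c (C′ ∷ Cs) β × Good (Adj L) c (C′ ∷ Cs)
    paint′ (b ∷ β) =
      let c , (eq , ps) , good = paint (b ∷ β)
      in c , ((λ e → eq (from e)) , ps) , λ cyc → forward (good cyc)
      where
      forward : ∀ {D} → Any (D ⊑_) (C ∷ Cs) → Any (D ⊑_) (C′ ∷ Cs)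
      forward (here D⊑)  = here (λ e → to (D⊑ e))
      forward (there D⊑) = there D⊑

  -- Lengthening acts on the head of the family, so the second cycle of a pair has to be brought
  -- there.
  config-swap : {C C′ : List (Fin n)} {Cs : List (List (Fin n))} →
                Config S L (C ∷ C′ ∷ Cs) → Config S L (C′ ∷ C ∷ Cs)
  config-swap {C} {C′} {Cs} K = record
    { core = core ; contained = contained ∘ any-swap
    ; spare = record { DisjointFreeEdges spare hiding (first; second; avoiding)
                     ; first = relax (DisjointFreeEdges.first spare)
                     ; second = relax (DisjointFreeEdges.second spare) }
    ; paint = paint′ }
    where
    open Config K
    any-swap : {P : List (Fin n) → Set} {A B : List (Fin n)} → Any P (A ∷ B ∷ Cs) → Any P (B ∷ A ∷ Cs)
    any-swap (here o)          = there (here o)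
    any-swap (there (here o))  = here o
    any-swap (there (there o)) = there (there o)
    relax : ∀ {u v} → FreeEdge L (C ∷ C′ ∷ Cs) u v → FreeEdge L (C′ ∷ C ∷ Cs) u v
    relax (free e ¬o) = free e (¬o ∘ any-swap)
    paint′ : (β : Palette (C′ ∷ C ∷ Cs)) → ∃ λ c → Paints c (C′ ∷ C ∷ Cs) β × Good (Adj L) c (C′ ∷ C ∷ Cs)
    paint′ (b ∷ b′ ∷ β) =
      let c , (eq , eq′ , ps) , good = paint (b′ ∷ b ∷ β)
      in c , (eq′ , eq , ps) , λ cyc → any-swap (good cyc)

  ∈∉⇒≢ : {p w : Fin n} → p ∈ S → w ∉ S → p ≢ w
  ∈∉⇒≢ p∈S w∉S refl = w∉S p∈S

  -- The third neighbour is the end `u′` of the second free edge. Two disjoint free edges remain: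
  -- `uw`, because `w` is on no cycle, and the untouched `u′v′`.
  add-vertex : {Cs : List (List (Fin n))} → Config S L Cs → (w : Fin n) → w ∉ S → ∃ λ L′ → Config (w ∷ S) L′ Cs
  add-vertex {Cs} K w w∉S = L′ , record
    { core      = fork
    ; contained = λ o → kept (contained o , not-uv o)
    ; spare     = record
      { u = u ; v = w ; u′ = u′ ; v′ = v′
      ; first  = free (swap wu) (w∉S ∘ onCycle⇒∈S ∘ onCycle-sym)
      ; second = free (kept (FreeEdge.edge second , [ ≢-sym u≢u′ ∘ proj₁ , ≢-sym v≢u′ ∘ proj₁ ]′))
                      (FreeEdge.¬on second)
      ; u≢u′ = u≢u′ ; u≢v′ = u≢v′ ; v≢u′ = ≢-sym z≢w
      ; v≢v′ = ≢-sym (∈S⇒≢w (closed (swap (FreeEdge.edge second)))) }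
    ; paint     = λ β → let c , ps , good = paint β in
        recolour w (exceptAt u′ (col c u v)) c , paints-cong {c = c} Cs (same-colour c) ps ,
        Subdivision.good-subdivide (adj-sym {L = L}) (adj-sym {L = L′}) uv u≢w v≢w u≢u′ v≢u′ nbr off c ¬uv good }
    where
    open Config K
    open DisjointFreeEdges spare
    uv = FreeEdge.edge first
    ¬uv = FreeEdge.¬on first
    open Fork core {w = w} uv w∉S (closed (FreeEdge.edge second)) (≢-sym u≢u′) (≢-sym v≢u′)
    not-uv : ∀ {p q} → OnCycle Cs p q → ¬ Same u v p q
    not-uv o (inj₁ (refl , refl)) = ¬uv o
    not-uv o (inj₂ (refl , refl)) = ¬uv (onCycle-sym o)
    same-colour : ∀ c {g p q} → OnCycle Cs p q → col (recolour w g c) p q ≡ col c p q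
    same-colour c {g} o = recolour-off w g c (∈S⇒≢w (onCycle⇒∈S o)) (∈S⇒≢w (onCycle⇒∈S (onCycle-sym o)))

  -- The third neighbour is `m`, the vertex after `h` on the cycle: it differs from `h` and `x` and
  -- is available even if the cycle uses all of `S`. The only deleted edge `hx` lies on the cycle,
  -- so both free edges survive.
  lengthen-cycle : {h m x : Fin n} (t : List (Fin n)) {Cs : List (List (Fin n))} →
                   Unique (h ∷ m ∷ t ++ [ x ]) → ¬ OnCycle Cs h x →
                   Config S L ((h ∷ m ∷ t ++ [ x ]) ∷ Cs) → (w : Fin n) → w ∉ S →
                   ∃ λ L′ → Config (w ∷ S) L′ ((w ∷ h ∷ m ∷ t ++ [ x ]) ∷ Cs)
  lengthen-cycle {h} {m} {x} t {Cs} uniq@(h∉ ∷ m∉ ∷ _) ¬hx K w w∉S = L′ , record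
    { core      = fork
    ; contained = contained′
    ; spare     = record { DisjointFreeEdges spare hiding (first; second; avoiding)
                         ; first = still-free (DisjointFreeEdges.first spare)
                         ; second = still-free (DisjointFreeEdges.second spare) }
    ; paint     = paint′ }
    where
    open Config K
    C C′ : List (Fin n)
    C  = h ∷ m ∷ t ++ [ x ]
    C′ = w ∷ C
    hx : OnCycle (C ∷ Cs) h x
    hx = here (closing-edge (m ∷ t))
    hm : OnCycle (C ∷ Cs) h m
    hm = here (inj₁ here)
    m≢h : m ≢ h
    m≢h = ≢-sym (All.head h∉)
    h≢x : h ≢ x
    h≢x = All.lookup h∉ (∈-++⁺ʳ (m ∷ t) (here refl))
    m≢x : m ≢ x
    m≢x = All.lookup m∉ (∈-++⁺ʳ t (here refl))
    open Fork core {w = w} (contained hx) w∉S (onCycle⇒∈S (onCycle-sym hm)) m≢h m≢x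
    no-return : ¬ Consec C x h
    no-return here      = h≢x refl
    no-return (there e) = All.lookup h∉ (consec-∈ʳ e) refl
    no-chord : ¬ Consec C h x
    no-chord here      = m≢x refl
    no-chord (there e) = All.lookup h∉ (consec-∈ˡ e) refl
    chordless : ∀ {p q} → PathEdge C p q → ¬ Same h x p q
    chordless (inj₁ e) (inj₁ (refl , refl)) = no-chord e
    chordless (inj₁ e) (inj₂ (refl , refl)) = no-return e
    chordless (inj₂ e) (inj₁ (refl , refl)) = no-return e
    chordless (inj₂ e) (inj₂ (refl , refl)) = no-chord e
    not-hx : ∀ {p q} → OnCycle Cs p q → ¬ Same h x p q
    not-hx o (inj₁ (refl , refl)) = ¬hx o
    not-hx o (inj₂ (refl , refl)) = ¬hx (onCycle-sym o)
    pathEdge⇒cycleEdge-C : ∀ {p q} → PathEdge C p q → CycleEdge C p q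
    pathEdge⇒cycleEdge-C = Sum.map consec-++ˡ consec-++ˡ
    pathEdge⇒onCycle : ∀ {p q} → PathEdge C p q → OnCycle (C ∷ Cs) p q
    pathEdge⇒onCycle = here ∘ pathEdge⇒cycleEdge-C
    contained′ : ∀ {p q} → OnCycle (C′ ∷ Cs) p q → Adj L′ p q
    contained′ (there o) = kept (contained (there o) , not-hx o)
    contained′ (here e) with cycleEdge-∷⁻ (m ∷ t) e
    ... | inj₁ (inj₁ (refl , refl))        = wu
    ... | inj₁ (inj₂ (refl , refl))        = swap wu
    ... | inj₂ (inj₁ (inj₁ (refl , refl))) = wv
    ... | inj₂ (inj₁ (inj₂ (refl , refl))) = swap wv
    ... | inj₂ (inj₂ pe)                   = kept (contained (pathEdge⇒onCycle pe) , chordless pe)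
    still-free : ∀ {u v} → FreeEdge L (C ∷ Cs) u v → FreeEdge L′ (C′ ∷ Cs) u v
    still-free {u} {v} (free e ¬o) = free (kept (e , ¬hx′)) ¬o′
      where
      ¬hx′ : ¬ Same h x u v
      ¬hx′ (inj₁ (refl , refl)) = ¬o hx
      ¬hx′ (inj₂ (refl , refl)) = ¬o (onCycle-sym hx)
      u≢w′ : u ≢ w
      u≢w′ = ∈S⇒≢w (closed e)
      v≢w′ : v ≢ w
      v≢w′ = ∈S⇒≢w (closed (swap e))
      ¬o′ : ¬ OnCycle (C′ ∷ Cs) u v
      ¬o′ (there o) = ¬o (there o)
      ¬o′ (here e) with cycleEdge-∷⁻ (m ∷ t) e
      ... | inj₁ (inj₁ (eq , _))        = u≢w′ eq
      ... | inj₁ (inj₂ (_ , eq))        = v≢w′ eq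
      ... | inj₂ (inj₁ (inj₁ (eq , _))) = u≢w′ eq
      ... | inj₂ (inj₁ (inj₂ (_ , eq))) = v≢w′ eq
      ... | inj₂ (inj₂ pe)              = ¬o (pathEdge⇒onCycle pe)
    paint′ : (β : Palette (C′ ∷ Cs)) → ∃ λ c → Paints c (C′ ∷ Cs) β × Good (Adj L′) c (C′ ∷ Cs)
    paint′ (b ∷ β) with paint (b ∷ β)
    ... | c , (eq , ps) , good =
      c′ , (painted , paints-cong {c = c} Cs (λ o → old-colour (there o)) ps)
         , good-lengthen (m ∷ t) uniq ¬hx good
      where
      open SubdivideCycle (adj-sym {L = L}) (adj-sym {L = L′}) (contained hx) u≢w v≢w
                          (≢-sym m≢h) (≢-sym m≢x) nbr off c
      old-colour : ∀ {p q} → OnCycle (C ∷ Cs) p q → col c′ p q ≡ col c p q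
      old-colour o = recolour-off w _ c (∈S⇒≢w (onCycle⇒∈S o)) (∈S⇒≢w (onCycle⇒∈S (onCycle-sym o)))
      b₀≡b : b₀ ≡ b
      b₀≡b = eq (closing-edge (m ∷ t))
      new-colour : ∀ {s p q} → s ≢ m → Same w s p q → col c′ p q ≡ b
      new-colour {s} s≢m (inj₁ (refl , refl)) = trans (recolour-at w _ c s) (trans (exceptAt-≢ s≢m) b₀≡b)
      new-colour {s} s≢m (inj₂ (refl , refl)) = trans (proj₂ c′ s w) (new-colour s≢m (inj₁ (refl , refl)))
      painted : ∀ {p q} → CycleEdge C′ p q → col c′ p q ≡ b
      painted e with cycleEdge-∷⁻ (m ∷ t) e
      ... | inj₁ same        = new-colour (≢-sym m≢h) same
      ... | inj₂ (inj₁ same) = new-colour (≢-sym m≢x) same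
      ... | inj₂ (inj₂ pe)   = trans (old-colour (here (pathEdge⇒cycleEdge-C pe))) (eq (pathEdge⇒cycleEdge-C pe))

  -- The free edge uv is replaced by u a and b v, where b a x is the new triangle. Each of a, b has
  -- one edge leaving the triangle, which receives the colour opposite to that of the triangle.
  add-triangle : {Cs : List (List (Fin n))} → Config S L Cs → {x a b : Fin n} →
                 x ∈ S → a ∉ S → b ∉ S → a ≢ b → ∃ λ L′ → Config (b ∷ a ∷ S) L′ ((b ∷ a ∷ x ∷ []) ∷ Cs)
  add-triangle {Cs} K {x} {a} {b} x∈S a∉S b∉S a≢b
    with u , v , free uv ¬uv , u≢x , v≢x ← DisjointFreeEdges.avoiding (Config.spare K) x = F₂.L′ , record
    { core      = F₂.fork
    ; contained = contained′
    ; spare     = record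
      { u = u ; v = a ; u′ = b ; v′ = v
      ; first  = free ua λ { (here e)  → not-in-Δ u≢b F₁.u≢w u≢x (cycleEdge-∈ˡ e)
                           ; (there o) → a∉S (onCycle⇒∈S (onCycle-sym o)) }
      ; second = free F₂.wv λ { (here e)  → not-in-Δ (≢-sym b≢v) F₁.v≢w v≢x (cycleEdge-∈ʳ e)
                              ; (there o) → b∉S (onCycle⇒∈S o) }
      ; u≢u′ = u≢b ; u≢v′ = F₁.u≢v ; v≢u′ = a≢b ; v≢v′ = ≢-sym F₁.v≢w }
    ; paint     = paint′ }
    where
    open Config K
    module F₁ = Fork core {w = a} uv a∉S x∈S (≢-sym u≢x) (≢-sym v≢x)
    b∉S₁ : b ∉ a ∷ S
    b∉S₁ (here eq) = a≢b (≡-sym eq)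
    b∉S₁ (there i) = b∉S i
    -- The second fork replaces `av` by the path `a b v`; as both forks take `x` for third
    -- neighbour, the triangle `b a x` arises.
    module F₂ = Fork F₁.fork {w = b} F₁.wv b∉S₁ (there x∈S) F₁.z≢w (≢-sym v≢x)
    Δ : List (Fin _)
    Δ = b ∷ a ∷ x ∷ []
    u≢b : u ≢ b
    u≢b = ∈∉⇒≢ (closed uv) b∉S
    b≢v : b ≢ v
    b≢v = ≢-sym (∈∉⇒≢ (closed (swap uv)) b∉S)
    x≢b : x ≢ b
    x≢b = F₂.z≢w
    not-in-Δ : ∀ {s} → s ≢ b → s ≢ a → s ≢ x → s ∉ Δ
    not-in-Δ s≢b _ _ (here eq)                 = s≢b eq
    not-in-Δ _ s≢a _ (there (here eq))         = s≢a eq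
    not-in-Δ _ _ s≢x (there (there (here eq))) = s≢x eq
    ua : Adj F₂.L′ u a
    ua = F₂.kept (swap F₁.wu , [ F₁.u≢w ∘ proj₁ , F₁.u≢v ∘ proj₁ ]′)
    ax₁ : (Adj F₁.L′ ∖ (a , v)) a x
    ax₁ = F₁.wz , [ ≢-sym v≢x ∘ proj₂ , ≢-sym F₁.v≢w ∘ proj₁ ]′
    triangle⁻ : ∀ {p q} → CycleEdge Δ p q → Triangle b a x p q
    triangle⁻ (inj₁ here)                                  = inj₁ (inj₁ (refl , refl))
    triangle⁻ (inj₁ (there here))                          = inj₂ (inj₂ (inj₁ (refl , refl)))
    triangle⁻ (inj₁ (there (there here)))                  = inj₂ (inj₁ (inj₂ (refl , refl)))
    triangle⁻ (inj₁ (there (there (there (there ())))))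
    triangle⁻ (inj₂ here)                                  = inj₁ (inj₂ (refl , refl))
    triangle⁻ (inj₂ (there here))                          = inj₂ (inj₂ (inj₂ (refl , refl)))
    triangle⁻ (inj₂ (there (there here)))                  = inj₂ (inj₁ (inj₁ (refl , refl)))
    triangle⁻ (inj₂ (there (there (there (there ())))))
    triangle⁺ : ∀ {p q} → Triangle b a x p q → CycleEdge Δ p q
    triangle⁺ (inj₁ (inj₁ (refl , refl)))        = inj₁ here
    triangle⁺ (inj₁ (inj₂ (refl , refl)))        = inj₂ here
    triangle⁺ (inj₂ (inj₁ (inj₁ (refl , refl)))) = inj₂ (there (there here))
    triangle⁺ (inj₂ (inj₁ (inj₂ (refl , refl)))) = inj₁ (there (there here))
    triangle⁺ (inj₂ (inj₂ (inj₁ (refl , refl)))) = inj₁ (there here)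
    triangle⁺ (inj₂ (inj₂ (inj₂ (refl , refl)))) = inj₂ (there here)
    old≢a : ∀ {p q} → OnCycle Cs p q → p ≢ a
    old≢a o = ∈∉⇒≢ (onCycle⇒∈S o) a∉S
    old≢b : ∀ {p q} → OnCycle Cs p q → p ≢ b
    old≢b o = ∈∉⇒≢ (onCycle⇒∈S o) b∉S
    contained′ : ∀ {p q} → OnCycle (Δ ∷ Cs) p q → Adj F₂.L′ p q
    contained′ (here e) with triangle⁻ e
    ... | inj₁ (inj₁ (refl , refl))        = F₂.wu
    ... | inj₁ (inj₂ (refl , refl))        = swap F₂.wu
    ... | inj₂ (inj₁ (inj₁ (refl , refl))) = F₂.wz
    ... | inj₂ (inj₁ (inj₂ (refl , refl))) = swap F₂.wz
    ... | inj₂ (inj₂ (inj₁ (refl , refl))) = F₂.kept ax₁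
    ... | inj₂ (inj₂ (inj₂ (refl , refl))) = swap (F₂.kept ax₁)
    contained′ (there o) = F₂.kept
      ( F₁.kept (contained o , λ { (inj₁ (refl , refl)) → ¬uv o ; (inj₂ (refl , refl)) → ¬uv (onCycle-sym o) })
      , [ old≢a o ∘ proj₁ , old≢a (onCycle-sym o) ∘ proj₂ ]′ )
    paint′ : (β : Palette (Δ ∷ Cs)) → ∃ λ c → Paints c (Δ ∷ Cs) β × Good (Adj F₂.L′) c (Δ ∷ Cs)
    paint′ (b₀ ∷ β) with paint β
    ... | c , ps , good = c₂ , (painted ∘ triangle⁻ , paints-cong {c = c} Cs old-colour ps) , good₂
      where
      g₁ g₂ : Fin _ → Bool
      g₁ = exceptAt u b₀
      g₂ = exceptAt v b₀
      c₁ c₂ : SymColouring _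
      c₁ = recolour a g₁ c
      c₂ = recolour b g₂ c₁
      -- The intermediate graph without `av`: there `a` has only the edges to `x` and `u`, in
      -- different colours, so it lies on no monochromatic cycle.
      R₁ : Rel _
      R₁ = Adj F₁.L′ ∖ (a , v)
      R₁-nbr : ∀ {q} → R₁ a q → q ≡ x ⊎ q ≡ u
      R₁-nbr (e , ¬av) with F₁.nbr e
      ... | inj₁ eq          = inj₂ eq
      ... | inj₂ (inj₁ refl) = ⊥-elim (¬av (inj₁ (refl , refl)))
      ... | inj₂ (inj₂ eq)   = inj₁ eq
      good₁ : Good R₁ c₁ Cs
      good₁ = good-attach (∖-sym {R = Adj F₁.L′} (adj-sym {L = F₁.L′}))
                (λ p≢a q≢a (e , _) → proj₁ (F₁.off p≢a q≢a e)) c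
                (λ e e′ → exceptAt-separates {b = b₀} (≢-sym u≢x) (R₁-nbr e) (R₁-nbr e′)) good
      old-colour : ∀ {p q} → OnCycle Cs p q → col c₂ p q ≡ col c p q
      old-colour o = trans (recolour-off b g₂ c₁ (old≢b o) (old≢b (onCycle-sym o)))
                           (recolour-off a g₁ c (old≢a o) (old≢a (onCycle-sym o)))
      ax-colour : col c₁ a x ≡ b₀
      ax-colour = trans (recolour-at a g₁ c x) (exceptAt-≢ (≢-sym u≢x))
      at-b : ∀ {s} → s ≢ v → col c₂ b s ≡ b₀
      at-b {s} s≢v = trans (recolour-at b g₂ c₁ s) (exceptAt-≢ s≢v)
      a≢v : a ≢ v
      a≢v = ≢-sym F₁.v≢w
      ax-colour₂ : col c₂ a x ≡ b₀
      ax-colour₂ = trans (recolour-off b g₂ c₁ a≢b x≢b) ax-colour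
      painted : ∀ {p q} → Triangle b a x p q → col c₂ p q ≡ b₀
      painted (inj₁ (inj₁ (refl , refl)))        = at-b a≢v
      painted (inj₁ (inj₂ (refl , refl)))        = trans (proj₂ c₂ a b) (at-b a≢v)
      painted (inj₂ (inj₁ (inj₁ (refl , refl)))) = at-b (≢-sym v≢x)
      painted (inj₂ (inj₁ (inj₂ (refl , refl)))) = trans (proj₂ c₂ x b) (at-b (≢-sym v≢x))
      painted (inj₂ (inj₂ (inj₁ (refl , refl)))) = ax-colour₂
      painted (inj₂ (inj₂ (inj₂ (refl , refl)))) = trans (proj₂ c₂ x a) ax-colour₂
      R₂-sym : ∀ {β} → Symmetric (Class (Adj F₂.L′) c₂ β)
      R₂-sym {β} = class-sym {R = Adj F₂.L′} {c = c₂} {β} swap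
      off₂ : ∀ {β p q} → p ≢ b → q ≢ b → Class (Adj F₂.L′) c₂ β p q → Class R₁ c₁ β p q
      off₂ p≢b q≢b (e , eq) = F₂.off p≢b q≢b e , trans (≡-sym (recolour-off b g₂ c₁ p≢b q≢b)) eq
      good₂ : Good (Adj F₂.L′) c₂ (Δ ∷ Cs)
      good₂ {β} {D} cyc with Any.any? (b ≟_) D | β Bool.≟ b₀
      ... | no b∉D  | _ = there (good₁ (cycle-off b∉D off₂ cyc))
      ... | yes b∈D | no β≢b₀ = ⊥-elim (leaf R₂-sym (λ r s → trans (only-v r) (≡-sym (only-v s))) cyc b∈D)
        where
        only-v : ∀ {q} → Class (Adj F₂.L′) c₂ β b q → q ≡ v
        only-v (e , eq) with F₂.nbr e
        ... | inj₁ refl        = ⊥-elim (β≢b₀ (trans (≡-sym eq) (at-b a≢v)))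
        ... | inj₂ (inj₁ eq′)  = eq′
        ... | inj₂ (inj₂ refl) = ⊥-elim (β≢b₀ (trans (≡-sym eq) (at-b (≢-sym v≢x))))
      ... | yes b∈D | yes refl with shortcut {u = a} {v = x} R₂-sym nbr₂ cyc b∈D
        where
        nbr₂ : ∀ {q} → Class (Adj F₂.L′) c₂ b₀ b q → q ≡ a ⊎ q ≡ x
        nbr₂ (e , eq) with F₂.nbr e
        ... | inj₁ eq′         = inj₁ eq′
        ... | inj₂ (inj₁ refl) = ⊥-elim (Bool.not-¬ refl
          (trans (≡-sym eq) (trans (recolour-at b g₂ c₁ v) (exceptAt-≡ v))))
        ... | inj₂ (inj₂ eq′)  = inj₂ eq′
      ...   | inj₁ (_ , tri) = here (λ e → triangle⁺ (tri e))
      -- Suppressing `b` gives a monochromatic cycle of `R₁` through `ax`; it would lie in an old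
      -- cycle, but `a` is new.
      ...   | inj₂ s = ⊥-elim (a∉S (onCycle⇒∈S (⊑-onCycle (good₁ (cycle-mono (λ _ _ → embed) cycle)) uses)))
        where
        open Shortcut s
        embed : ∀ {p q} → (p ≢ b × q ≢ b × Class (Adj F₂.L′) c₂ b₀ p q) ⊎ Same a x p q → Class R₁ c₁ b₀ p q
        embed (inj₁ (p≢b , q≢b , r))      = off₂ p≢b q≢b r
        embed (inj₂ (inj₁ (refl , refl))) = ax₁ , ax-colour
        embed (inj₂ (inj₂ (refl , refl))) =
          ∖-sym {R = Adj F₁.L′} {a , v} (adj-sym {L = F₁.L′}) ax₁ , trans (proj₂ c₁ x a) ax-colour

-- Deciding properties of the cycles of a small graph by exhaustive search

module Search {R : Rel n} (R? : ∀ p q → Dec (R p q)) {P : List (Fin n) → Set} (P? : ∀ D → Dec (P D)) where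

  -- Depth-first search: `pre ++ [ v ]` is the simple path walked so far from `s`, and `P` is
  -- demanded each time it can be closed to a cycle.
  Explored : ℕ → Fin n → Fin n → List (Fin n) → Set
  -- Running out of fuel counts as failure, so a successful search is conclusive. Initial fuel `n`
  -- outlasts every simple path.
  Explored zero    s v pre = ⊥
  Explored (suc f) s v pre =
    (R v s → 3 ≤ length (pre ++ [ v ]) → P (pre ++ [ v ])) ×
    (∀ y → R v y → y ∉ pre ++ [ v ] → Explored f s y (pre ++ [ v ]))

  explored? : ∀ f s v pre → Dec (Explored f s v pre)
  explored? zero    s v pre = no id
  explored? (suc f) s v pre =
    (R? v s →-dec 3 ℕ.≤? _ →-dec P? _) ×-dec
    all? λ y → R? v y →-dec ¬? (Any.any? (y ≟_) _) →-dec explored? f s y _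

  explored : ∀ f s v pre → Explored f s v pre → ∀ l → Unique (pre ++ v ∷ l) → 3 ≤ length (pre ++ v ∷ l) →
             (∀ {p q} → Consec ((v ∷ l) ++ [ s ]) p q → R p q) → P (pre ++ v ∷ l)
  explored (suc f) s v pre (close , extend) []      u long steps = close (steps here) long
  explored (suc f) s v pre (close , extend) (y ∷ l) u long steps =
    subst P assoc (explored f s y (pre ++ [ v ]) (extend y (steps here) y∉) l
      u′ (subst (λ m → 3 ≤ length m) (≡-sym assoc) long) (steps ∘ there))
    where
    assoc : (pre ++ [ v ]) ++ y ∷ l ≡ pre ++ v ∷ y ∷ l
    assoc = ++-assoc pre [ v ] (y ∷ l)
    u′ : Unique ((pre ++ [ v ]) ++ y ∷ l)
    u′ = subst Unique (≡-sym assoc) u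
    y∉ : y ∉ pre ++ [ v ]
    y∉ i = Unique.Unique[x∷xs]⇒x∉xs (unique-↭ (++-comm (pre ++ [ v ]) (y ∷ l)) u′) (∈-++⁺ʳ l i)

  Exhausted : Set
  Exhausted = ∀ s → Explored n s s []

  exhausted? : Dec Exhausted
  exhausted? = all? λ s → explored? n s s []

  exhausted : Exhausted → ∀ {D} → Cycle R D → P D
  exhausted ex {[]}    cyc with () ← Cycle.long cyc
  exhausted ex {x ∷ l} cyc = explored n x x [] (ex x) l (Cycle.unique cyc) (Cycle.long cyc) (Cycle.steps cyc)

consec? : (l : List (Fin n)) (p q : Fin n) → Dec (Consec l p q)
consec? []          p q = no λ ()
consec? (_ ∷ [])    p q = no λ { (there ()) }
consec? (x ∷ y ∷ l) p q = map′ to from ((x ≟ p ×-dec y ≟ q) ⊎-dec consec? (y ∷ l) p q)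
  where
  to : (x ≡ p × y ≡ q) ⊎ Consec (y ∷ l) p q → Consec (x ∷ y ∷ l) p q
  to (inj₁ (refl , refl)) = here
  to (inj₂ e)             = there e
  from : Consec (x ∷ y ∷ l) p q → (x ≡ p × y ≡ q) ⊎ Consec (y ∷ l) p q
  from here      = inj₁ (refl , refl)
  from (there e) = inj₂ e

allConsec? : {Q : Rel n} → (∀ p q → Dec (Q p q)) → (l : List (Fin n)) → Dec (∀ {p q} → Consec l p q → Q p q)
allConsec? Q? []          = yes λ ()
allConsec? Q? (_ ∷ [])    = yes λ { (there ()) }
allConsec? {Q = Q} Q? (x ∷ y ∷ l) = map′ to (λ f → f here , λ e → f (there e)) (Q? x y ×-dec allConsec? Q? (y ∷ l))
  where
  to : Q x y × (∀ {p q} → Consec (y ∷ l) p q → Q p q) → ∀ {p q} → Consec (x ∷ y ∷ l) p q → Q p q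
  to (r , f) here      = r
  to (r , f) (there e) = f e

cycleEdge? : (C : List (Fin n)) (p q : Fin n) → Dec (CycleEdge C p q)
cycleEdge? C p q = consec? (closeUp C) p q ⊎-dec consec? (closeUp C) q p

_⊑?_ : (D C : List (Fin n)) → Dec (D ⊑ C)
D ⊑? C = allConsec? (cycleEdge? C) (closeUp D)

same? : (u v p q : Fin n) → Dec (Same u v p q)
same? u v p q = (p ≟ u ×-dec q ≟ v) ⊎-dec (p ≟ v ×-dec q ≟ u)

adj? : (L : Edges n) (p q : Fin n) → Dec (Adj L p q)
adj? []            p q = no [ (λ ()) , (λ ()) ]′
adj? ((u , v) ∷ L) p q = map′ [ adj-here , adj-there ]′ adj-∷⁻ (same? u v p q ⊎-dec adj? L p q)

simple? : (L : Edges n) → Dec (Simple L)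
simple? []            = yes tt
simple? ((u , v) ∷ L) = ¬? (u ≟ v) ×-dec ¬? (adj? L u v) ×-dec simple? L

split-colouring : Edges n → Bool → SymColouring n
split-colouring L b = (λ p q → colour (does (adj? L p q))) ,
                      λ p q → cong colour (does-⇔ (mk⇔ swap swap) (adj? L p q) (adj? L q p))
  where
  colour : Bool → Bool
  colour d = if d then b else not b

class? : {R : Rel n} → (∀ p q → Dec (R p q)) → (c : SymColouring n) (b : Bool) → ∀ p q → Dec (Class R c b p q)
class? R? c b p q = R? p q ×-dec col c p q Bool.≟ b

module _ {R : Rel n} (R? : ∀ p q → Dec (R p q)) (c : SymColouring n) (Cs : List (List (Fin n))) where

  module Classes (b : Bool) = Search (class? R? c b) (λ D → Any.any? (D ⊑?_) Cs)

  BothExhausted : Set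
  BothExhausted = Classes.Exhausted true × Classes.Exhausted false

  both? : Dec BothExhausted
  both? = Classes.exhausted? true ×-dec Classes.exhausted? false

  both⇒good : BothExhausted → Good R c Cs
  both⇒good (ex , _) {true}  = Classes.exhausted true ex
  both⇒good (_ , ex) {false} = Classes.exhausted false ex

cycle-colour? : (c : SymColouring n) (C : List (Fin n)) (b : Bool) →
                Dec (∀ {p q} → Consec (closeUp C) p q → col c p q ≡ b)
cycle-colour? c C b = allConsec? (λ p q → col c p q Bool.≟ b) (closeUp C)

cycle-colour : (c : SymColouring n) (C : List (Fin n)) {b : Bool} →
               (∀ {p q} → Consec (closeUp C) p q → col c p q ≡ b) →
               ∀ {p q} → CycleEdge C p q → col c p q ≡ b
cycle-colour c C f (inj₁ e) = f e
cycle-colour c C f (inj₂ e) = trans (proj₂ c _ _) (f e)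

-- Each edge e is listed with one of two forests that partition the graph minus e.
Removals : ℕ → Set
Removals n = List ((Fin n × Fin n) × Edges n)

module Table (table : Removals n) where

  L : Edges n
  L = map proj₁ table

  ∖? : ∀ e p q → Dec ((Adj L ∖ e) p q)
  ∖? (u , v) p q = adj? L p q ×-dec ¬? (same? u v p q)

  -- For a concrete table the hypotheses in braces are settled by evaluating the decision
  -- procedures.
  table-core : n + n ≡ suc (length L) →
               {True (simple? L)} → {True (all? λ p → any? λ q → adj? L p q)} →
               {True (All.all? (λ (e , M) → both? (∖? e) (split-colouring M true) []) table)} → Core (allFin n) L
  table-core count {s} {cov} {crit} = record
    { count    = trans (cong (λ k → k + k) (length-tabulate {n = n} id)) count
    ; simple   = toWitness s
    ; closed   = λ _ → ∈-allFin _
    ; covered  = λ {p} _ → toWitness cov p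
    ; critical = [ entry , (λ i → let c , good = entry i in
        c , λ cyc → good (cycle-mono (λ _ _ ((e , ne) , eq) → (e , ne ∘ same-flip) , eq) cyc)) ]′ }
    where
    entry : ∀ {p q} → (p , q) ∈ L → ∃ λ c → Good (Adj L ∖ (p , q)) c []
    entry i with ∈-map⁻ proj₁ i
    ... | (e , M) , j , refl = 
      split-colouring M true , both⇒good (∖? e) (split-colouring M true) [] (All.lookup (toWitness crit) j)

-- The starting graphs and the cycles inside them

K₅⁻ : Removals 5
K₅⁻ = ((0F , 1F) , (0F , 2F) ∷ (0F , 3F) ∷ (1F , 2F) ∷ (1F , 4F) ∷ [])
    ∷ ((0F , 2F) , (0F , 1F) ∷ (0F , 3F) ∷ (1F , 2F) ∷ (1F , 4F) ∷ [])
    ∷ ((0F , 3F) , (0F , 1F) ∷ (0F , 2F) ∷ (1F , 3F) ∷ (1F , 4F) ∷ [])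
    ∷ ((0F , 4F) , (0F , 1F) ∷ (0F , 2F) ∷ (1F , 3F) ∷ (1F , 4F) ∷ [])
    ∷ ((1F , 2F) , (0F , 1F) ∷ (0F , 2F) ∷ (0F , 3F) ∷ (1F , 4F) ∷ [])
    ∷ ((1F , 3F) , (0F , 1F) ∷ (0F , 2F) ∷ (0F , 3F) ∷ (1F , 4F) ∷ [])
    ∷ ((1F , 4F) , (0F , 1F) ∷ (0F , 2F) ∷ (0F , 4F) ∷ (1F , 3F) ∷ [])
    ∷ ((2F , 3F) , (0F , 1F) ∷ (0F , 2F) ∷ (0F , 3F) ∷ (1F , 4F) ∷ [])
    ∷ ((2F , 4F) , (0F , 1F) ∷ (0F , 2F) ∷ (0F , 4F) ∷ (1F , 3F) ∷ [])
    ∷ []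

-- The triangles `0 1 2` and `3 4 5`, linked by the five edges of the path `0 3 1 4 2 5`.
linked-triangles : Removals 6
linked-triangles
  = ((0F , 1F) , (1F , 2F) ∷ (0F , 2F) ∷ (3F , 4F) ∷ (4F , 5F) ∷ (1F , 3F) ∷ [])
  ∷ ((1F , 2F) , (0F , 1F) ∷ (0F , 2F) ∷ (3F , 4F) ∷ (4F , 5F) ∷ (1F , 3F) ∷ [])
  ∷ ((0F , 2F) , (0F , 1F) ∷ (1F , 2F) ∷ (3F , 4F) ∷ (4F , 5F) ∷ (1F , 3F) ∷ [])
  ∷ ((3F , 4F) , (0F , 1F) ∷ (1F , 2F) ∷ (4F , 5F) ∷ (3F , 5F) ∷ (0F , 3F) ∷ [])
  ∷ ((4F , 5F) , (0F , 1F) ∷ (1F , 2F) ∷ (3F , 4F) ∷ (3F , 5F) ∷ (0F , 3F) ∷ [])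
  ∷ ((3F , 5F) , (0F , 1F) ∷ (1F , 2F) ∷ (3F , 4F) ∷ (4F , 5F) ∷ (0F , 3F) ∷ [])
  ∷ ((0F , 3F) , (0F , 1F) ∷ (1F , 2F) ∷ (3F , 4F) ∷ (4F , 5F) ∷ (1F , 3F) ∷ [])
  ∷ ((1F , 3F) , (0F , 1F) ∷ (1F , 2F) ∷ (3F , 4F) ∷ (4F , 5F) ∷ (0F , 3F) ∷ [])
  ∷ ((1F , 4F) , (0F , 1F) ∷ (1F , 2F) ∷ (3F , 4F) ∷ (4F , 5F) ∷ (0F , 3F) ∷ [])
  ∷ ((2F , 4F) , (0F , 1F) ∷ (1F , 2F) ∷ (3F , 4F) ∷ (4F , 5F) ∷ (0F , 3F) ∷ [])
  ∷ ((2F , 5F) , (0F , 1F) ∷ (1F , 2F) ∷ (3F , 4F) ∷ (4F , 5F) ∷ (0F , 3F) ∷ [])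
  ∷ []

K₅⁻-core : Core (allFin 5) (Table.L K₅⁻)
K₅⁻-core = Table.table-core K₅⁻ refl

linked-triangles-core : Core (allFin 6) (Table.L linked-triangles)
linked-triangles-core = Table.table-core linked-triangles refl

onCycle? : (Cs : List (List (Fin n))) (p q : Fin n) → Dec (OnCycle Cs p q)
onCycle? Cs p q = Any.any? (λ C → cycleEdge? C p q) Cs

freeEdge : (L : Edges n) (Cs : List (List (Fin n))) (u v : Fin n) → 
           {True (adj? L u v)} → {True (¬? (onCycle? Cs u v))} → FreeEdge L Cs u v
freeEdge L Cs u v {e} {ne} = free (toWitness e) (toWitness ne)

paints? : (c : SymColouring n) (Cs : List (List (Fin n))) (β : Palette Cs) → Dec (Paints c Cs β)
paints? c []       []      = yes tt
paints? c (C ∷ Cs) (b ∷ β) =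
  map′ (cycle-colour c C) (λ f e → f (inj₁ e)) (cycle-colour? c C b) ×-dec paints? c Cs β

painted : (L : Edges n) (Cs : List (List (Fin n))) (β : Palette Cs) (M : Edges n) (b : Bool) →
          {True (paints? (split-colouring M b) Cs β)} → {True (both? (adj? L) (split-colouring M b) Cs)} →
          ∃ λ c → Paints c Cs β × Good (Adj L) c Cs
painted L Cs β M b {p} {g} =
  split-colouring M b , toWitness p , both⇒good (adj? L) (split-colouring M b) Cs (toWitness g)

contained-by-search : (L : Edges n) (Cs : List (List (Fin n))) →
                      {True (all? λ p → all? λ q → onCycle? Cs p q →-dec adj? L p q)} →
                      ∀ {p q} → OnCycle Cs p q → Adj L p q
contained-by-search L Cs {t} {p} {q} = toWitness t p q

triangle-in-K₅⁻ : Config (allFin 5) (Table.L K₅⁻) ((0F ∷ 1F ∷ 2F ∷ []) ∷ [])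
triangle-in-K₅⁻ = record
  { core = K₅⁻-core ; contained = contained-by-search L Cs
  ; spare = record
    { u = 0F ; v = 3F ; u′ = 1F ; v′ = 4F ; first = freeEdge L Cs 0F 3F ; second = freeEdge L Cs 1F 4F
    ; u≢u′ = λ () ; u≢v′ = λ () ; v≢u′ = λ () ; v≢v′ = λ () }
  ; paint = λ { (true ∷ []) → painted L Cs _ M true ; (false ∷ []) → painted L Cs _ M false } }
  where
  L : Edges 5
  L = Table.L K₅⁻
  Cs : List (List (Fin 5))
  Cs = (0F ∷ 1F ∷ 2F ∷ []) ∷ []
  M : Edges 5
  -- Outside the triangle, each of `3` and `4` is joined to `0`, `1` and `2`. Hanging `03` and `14`
  -- on the triangle leaves the path `0 4 2 3 1` for the other colour.
  M = (0F , 1F) ∷ (1F , 2F) ∷ (2F , 0F) ∷ (0F , 3F) ∷ (1F , 4F) ∷ []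

square-in-K₅⁻ : Config (allFin 5) (Table.L K₅⁻) ((0F ∷ 1F ∷ 2F ∷ 3F ∷ []) ∷ [])
square-in-K₅⁻ = record
  { core = K₅⁻-core ; contained = contained-by-search L Cs
  ; spare = record
    { u = 0F ; v = 2F ; u′ = 1F ; v′ = 4F ; first = freeEdge L Cs 0F 2F ; second = freeEdge L Cs 1F 4F
    ; u≢u′ = λ () ; u≢v′ = λ () ; v≢u′ = λ () ; v≢v′ = λ () }
  ; paint = λ { (true ∷ []) → painted L Cs _ M true ; (false ∷ []) → painted L Cs _ M false } }
  where
  L : Edges 5
  L = Table.L K₅⁻
  Cs : List (List (Fin 5))
  Cs = (0F ∷ 1F ∷ 2F ∷ 3F ∷ []) ∷ []
  M : Edges 5
  -- `04` joins the colour of the square because `02`, `04`, `24` form a triangle; the path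
  -- `0 2 4 1 3` is left.
  M = (0F , 1F) ∷ (1F , 2F) ∷ (2F , 3F) ∷ (3F , 0F) ∷ (0F , 4F) ∷ []

pentagon-in-K₅⁻ : Config (allFin 5) (Table.L K₅⁻) ((3F ∷ 0F ∷ 4F ∷ 1F ∷ 2F ∷ []) ∷ [])
pentagon-in-K₅⁻ = record
  { core = K₅⁻-core ; contained = contained-by-search L Cs
  ; spare = record
    { u = 0F ; v = 1F ; u′ = 2F ; v′ = 4F ; first = freeEdge L Cs 0F 1F ; second = freeEdge L Cs 2F 4F
    ; u≢u′ = λ () ; u≢v′ = λ () ; v≢u′ = λ () ; v≢v′ = λ () }
  ; paint = λ { (true ∷ []) → painted L Cs _ M true ; (false ∷ []) → painted L Cs _ M false } }
  where
  L : Edges 5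
  L = Table.L K₅⁻
  Cs : List (List (Fin 5))
  Cs = (3F ∷ 0F ∷ 4F ∷ 1F ∷ 2F ∷ []) ∷ []
  M : Edges 5
  -- The other colour receives the path `3 1 0 2 4`.
  M = (3F , 0F) ∷ (0F , 4F) ∷ (4F , 1F) ∷ (1F , 2F) ∷ (2F , 3F) ∷ []

-- The edges off the two triangles form the path `4 1 2 3`. It is one class if the triangles agree
-- in colour; otherwise `12` and `14` hang on the first triangle and `23` on the second.
bowtie-in-K₅⁻ : Config (allFin 5) (Table.L K₅⁻) ((1F ∷ 3F ∷ 0F ∷ []) ∷ (2F ∷ 4F ∷ 0F ∷ []) ∷ [])
bowtie-in-K₅⁻ = record
  { core = K₅⁻-core ; contained = contained-by-search L Cs
  ; spare = record
    { u = 1F ; v = 4F ; u′ = 2F ; v′ = 3F ; first = freeEdge L Cs 1F 4F ; second = freeEdge L Cs 2F 3F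
    ; u≢u′ = λ () ; u≢v′ = λ () ; v≢u′ = λ () ; v≢v′ = λ () }
  ; paint = λ { (true ∷ true ∷ [])   → painted L Cs _ (M ++ M′) true
              ; (true ∷ false ∷ [])  → painted L Cs _ (M ++ N) true
              ; (false ∷ true ∷ [])  → painted L Cs _ (M ++ N) false
              ; (false ∷ false ∷ []) → painted L Cs _ (M ++ M′) false } }
  where
  L : Edges 5
  L = Table.L K₅⁻
  Cs : List (List (Fin 5))
  Cs = (1F ∷ 3F ∷ 0F ∷ []) ∷ (2F ∷ 4F ∷ 0F ∷ []) ∷ []
  M M′ N : Edges 5
  M  = (1F , 3F) ∷ (3F , 0F) ∷ (0F , 1F) ∷ []
  M′ = (2F , 4F) ∷ (4F , 0F) ∷ (0F , 2F) ∷ []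
  N  = (1F , 2F) ∷ (1F , 4F) ∷ []

-- If the triangles agree in colour, the linking path is the other class. Otherwise its matching
-- `03`, `14`, `25` hangs on the first triangle, and `13`, `24` hang on the second.
disjoint-triangles : Config (allFin 6) (Table.L linked-triangles) ((0F ∷ 1F ∷ 2F ∷ []) ∷ (3F ∷ 4F ∷ 5F ∷ []) ∷ [])
disjoint-triangles = record
  { core = linked-triangles-core ; contained = contained-by-search L Cs
  ; spare = record
    { u = 0F ; v = 3F ; u′ = 1F ; v′ = 4F ; first = freeEdge L Cs 0F 3F ; second = freeEdge L Cs 1F 4F
    ; u≢u′ = λ () ; u≢v′ = λ () ; v≢u′ = λ () ; v≢v′ = λ () }
  ; paint = λ { (true ∷ true ∷ [])   → painted L Cs _ (M ++ M′) true
              ; (true ∷ false ∷ [])  → painted L Cs _ (M ++ N) true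
              ; (false ∷ true ∷ [])  → painted L Cs _ (M ++ N) false
              ; (false ∷ false ∷ []) → painted L Cs _ (M ++ M′) false } }
  where
  L : Edges 6
  L = Table.L linked-triangles
  Cs : List (List (Fin 6))
  Cs = (0F ∷ 1F ∷ 2F ∷ []) ∷ (3F ∷ 4F ∷ 5F ∷ []) ∷ []
  M M′ N : Edges 6
  M  = (0F , 1F) ∷ (1F , 2F) ∷ (2F , 0F) ∷ []
  M′ = (3F , 4F) ∷ (4F , 5F) ∷ (5F , 3F) ∷ []
  N  = (0F , 3F) ∷ (1F , 4F) ∷ (2F , 5F) ∷ []

-- Relabelling along an injection

module Relabel {k n : ℕ} (ι : Fin (suc k) → Fin n) (ι-injective : ∀ {i j} → ι i ≡ ι j → i ≡ j) where

  ι⁻¹ : Fin n → Fin (suc k)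
  ι⁻¹ p with any? (λ i → ι i ≟ p)
  ... | yes (i , _) = i
  -- An arbitrary value: every vertex of a cycle of the relabelled graph has an edge and hence lies
  -- in the image.
  ... | no _        = zero

  ι⁻¹∘ι : ∀ i → ι⁻¹ (ι i) ≡ i
  ι⁻¹∘ι i with any? (λ j → ι j ≟ ι i)
  ... | yes (_ , eq) = ι-injective eq
  ... | no ¬∃        = ⊥-elim (¬∃ (i , refl))

  relabel-edges : Edges (suc k) → Edges n
  relabel-edges = map (λ (i , j) → ι i , ι j)

  relabel-colouring : SymColouring (suc k) → SymColouring n
  relabel-colouring (c , c-sym) = (λ p q → c (ι⁻¹ p) (ι⁻¹ q)) , λ p q → c-sym (ι⁻¹ p) (ι⁻¹ q)

  data Image (R : Rel (suc k)) : Rel n where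
    image : ∀ {i j} → R i j → Image R (ι i) (ι j)

  preimage : ∀ {R i j} → Image R (ι i) (ι j) → R i j
  preimage {R} {i} {j} r = go r refl refl
    where
    go : ∀ {p q} → Image R p q → p ≡ ι i → q ≡ ι j → R i j
    go (image r) eq eq′ with refl ← ι-injective eq | refl ← ι-injective eq′ = r

  source : ∀ {R p q} → Image R p q → ∃ λ i → p ≡ ι i
  source (image _) = _ , refl

  adj⁻ : (L : Edges (suc k)) {p q : Fin n} → Adj (relabel-edges L) p q → Image (Adj L) p q
  adj⁻ L (inj₁ e) with _ , i , refl ← ∈-map⁻ _ e = image (inj₁ i)
  adj⁻ L (inj₂ e) with _ , i , refl ← ∈-map⁻ _ e = image (inj₂ i)

  adj⁺ : {L : Edges (suc k)} {i j : Fin (suc k)} → Adj L i j → Adj (relabel-edges L) (ι i) (ι j)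
  adj⁺ = Sum.map (∈-map⁺ _) (∈-map⁺ _)

  onCycle⁻ : (Cs : List (List (Fin (suc k)))) {p q : Fin n} → OnCycle (map (map ι) Cs) p q → Image (OnCycle Cs) p q
  onCycle⁻ (C ∷ Cs) (here e) with _ , _ , e′ , refl , refl ← cycleEdge-map⁻ ι C e = image (here e′)
  onCycle⁻ (C ∷ Cs) (there o) with image o′ ← onCycle⁻ Cs o = image (there o′)

  simple⁺ : (L : Edges (suc k)) → Simple L → Simple (relabel-edges L)
  simple⁺ []            _              = tt
  simple⁺ ((i , j) ∷ L) (i≢j , ¬ij , s) = i≢j ∘ ι-injective , ¬ij ∘ preimage ∘ adj⁻ L , simple⁺ L s

  relabel-good : {R : Rel (suc k)} {R′ : Rel n} (c : SymColouring (suc k)) {Cs : List (List (Fin (suc k)))} →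
                 Symmetric R′ → (∀ {p q} → R′ p q → Image R p q) → Good R c Cs →
                 Good R′ (relabel-colouring c) (map (map ι) Cs)
  relabel-good {R} {R′} c {Cs} R′-sym pre good {b} {D} cyc =
    Any.map⁺ (Any.map {P = map ι⁻¹ D ⊑_} {Q = λ C → D ⊑ map ι C} (λ D⊑ → back D⊑) (good (cycle-map ι⁻¹ inj hom cyc)))
    where
    hom : ∀ {p q} → Class R′ (relabel-colouring c) b p q → Class R c b (ι⁻¹ p) (ι⁻¹ q)
    hom (r , eq) with image {i} {j} r′ ← pre r = subst₂ R (≡-sym (ι⁻¹∘ι i)) (≡-sym (ι⁻¹∘ι j)) r′ , eq
    in-image : ∀ {p} → p ∈ D → ∃ λ i → p ≡ ι i
    in-image p∈D = source (pre (proj₁ (Through.first (through cyc p∈D))))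
    inj : ∀ {p q} → p ∈ D → q ∈ D → ι⁻¹ p ≡ ι⁻¹ q → p ≡ q
    inj p∈ q∈ eq with i , refl ← in-image p∈ | j , refl ← in-image q∈ =
      cong ι (trans (≡-sym (ι⁻¹∘ι i)) (trans eq (ι⁻¹∘ι j)))
    back : ∀ {C} → map ι⁻¹ D ⊑ C → D ⊑ map ι C
    back {C} D⊑ e with image {i} {j} _ ← pre (proj₁ (Cycle.steps cyc e)) =
      cycleEdge-map⁺ ι (subst₂ (CycleEdge C) (ι⁻¹∘ι i) (ι⁻¹∘ι j)
        (D⊑ (subst (λ l → Consec l _ _) (map-closeUp ι⁻¹ D) (consec-map⁺ ι⁻¹ e))))

  relabel-paints : (c : SymColouring (suc k)) (Cs : List (List (Fin (suc k)))) (β : Palette (map (map ι) Cs)) →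
                   Paints c Cs (All.map⁻ β) → Paints (relabel-colouring c) (map (map ι) Cs) β
  relabel-paints c []       []      _         = tt
  relabel-paints c (C ∷ Cs) (b ∷ β) (eq , ps) = eq′ , relabel-paints c Cs β ps
    where
    eq′ : ∀ {p q} → CycleEdge (map ι C) p q → _
    eq′ e with i , j , e′ , refl , refl ← cycleEdge-map⁻ ι C e =
      trans (cong₂ (col c) (ι⁻¹∘ι i) (ι⁻¹∘ι j)) (eq e′)

  relabel : {S : List (Fin (suc k))} {L : Edges (suc k)} {Cs : List (List (Fin (suc k)))} → Config S L Cs →
            Config (map ι S) (relabel-edges L) (map (map ι) Cs)
  relabel {S} {L} {Cs} K = record
    { core = record
      { count    = trans (cong (λ l → l + l) (length-map ι S)) (trans count (cong suc (≡-sym (length-map _ L))))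
      ; simple   = simple⁺ L simple
      ; closed   = λ e → closed′ (adj⁻ L e)
      ; covered  = covered′
      ; critical = λ e → critical′ (adj⁻ L e) }
    ; contained = λ o → contained′ (onCycle⁻ Cs o)
    ; spare     = record
      { u = ι u ; v = ι v ; u′ = ι u′ ; v′ = ι v′ ; first = free⁺ first ; second = free⁺ second
      ; u≢u′ = u≢u′ ∘ ι-injective ; u≢v′ = u≢v′ ∘ ι-injective 
      ; v≢u′ = v≢u′ ∘ ι-injective ; v≢v′ = v≢v′ ∘ ι-injective }
    ; paint     = λ β → let c , ps , good = paint (All.map⁻ β) in
        relabel-colouring c , relabel-paints c Cs β ps ,
        relabel-good c (adj-sym {L = relabel-edges L}) (adj⁻ L) good }
    where
    open Config K
    open DisjointFreeEdges spare
    closed′ : ∀ {p q} → Image (Adj L) p q → p ∈ map ι S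
    closed′ (image e) = ∈-map⁺ ι (closed e)
    covered′ : ∀ {p} → p ∈ map ι S → ∃ (Adj (relabel-edges L) p)
    covered′ i with s , s∈ , refl ← ∈-map⁻ ι i = let q , e = covered s∈ in ι q , adj⁺ e
    contained′ : ∀ {p q} → Image (OnCycle Cs) p q → Adj (relabel-edges L) p q
    contained′ (image o) = adj⁺ (contained o)
    free⁺ : ∀ {i j} → FreeEdge L Cs i j → FreeEdge (relabel-edges L) (map (map ι) Cs) (ι i) (ι j)
    free⁺ (free e ¬o) = free (adj⁺ e) (¬o ∘ preimage ∘ onCycle⁻ Cs)
    critical′ : ∀ {p q} → Image (Adj L) p q → ∃ λ c → Good (Adj (relabel-edges L) ∖ (p , q)) c []
    critical′ (image {i} {j} e) = let c , good = critical e in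
      relabel-colouring c ,
      relabel-good c (∖-sym {R = Adj (relabel-edges L)} (adj-sym {L = relabel-edges L}))
        (λ (r , ne) → pull (adj⁻ L r) ne) good
      where
      pull : ∀ {r s} → Image (Adj L) r s → ¬ Same (ι i) (ι j) r s → Image (Adj L ∖ (i , j)) r s
      pull (image r) ne = image (r , ne ∘ Sum.map (λ (a , b) → cong ι a , cong ι b) (λ (a , b) → cong ι a , cong ι b))

lookup-injective : (l : List (Fin n)) → Unique l → ∀ {i j} → lookup l i ≡ lookup l j → i ≡ j
lookup-injective (x ∷ l) _          {zero}  {zero}  _  = refl
lookup-injective (x ∷ l) (≢s ∷ _)   {zero}  {suc j} eq = ⊥-elim (All.lookup ≢s (∈-lookup j) eq)
lookup-injective (x ∷ l) (≢s ∷ _)   {suc i} {zero}  eq = ⊥-elim (All.lookup ≢s (∈-lookup i) (≡-sym eq))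
lookup-injective (x ∷ l) (_ ∷ u)    {suc i} {suc j} eq = cong suc (lookup-injective l u eq)

relabel-by : (v : Fin n) (vs : List (Fin n)) → Unique (v ∷ vs) → let ι = lookup (v ∷ vs) in
             {S : List (Fin (suc (length vs)))} {L : Edges (suc (length vs))}
             {Cs : List (List (Fin (suc (length vs))))} → Config S L Cs →
             ∃ λ L′ → Config (map ι S) L′ (map (map ι) Cs)
relabel-by v vs u K = _ , Relabel.relabel (lookup (v ∷ vs)) (lookup-injective (v ∷ vs) u) K

-- Building the configuration of a given family of cycles

split-end : (k : ℕ) (l : List A) → k ≤ length l → ∃₂ λ ws r → l ≡ ws ++ r × length r ≡ k
split-end k l k≤ with length l ℕ.≟ k
... | yes eq = [] , l , refl , eq
split-end zero []      _  | no ne = ⊥-elim (ne refl)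
split-end k    (x ∷ l) k≤ | no ne with split-end k l (ℕ.≤-pred (ℕ.≤∧≢⇒< k≤ (≢-sym ne)))
... | ws , r , refl , eq = x ∷ ws , r , refl , eq

-- If every vertex occurred in `l`, positions would inject `Fin n` into `Fin (length l)`.
fresh : (l : List (Fin n)) → length l < n → ∃ λ v → v ∉ l
fresh {n} l l<n with any? (λ v → ¬? (Any.any? (v ≟_) l))
... | yes v∉l = v∉l
... | no none = ⊥-elim (ℕ.<⇒≱ l<n (injective⇒≤ {f = λ v → Any.index (member v)} inj))
  where
  member : ∀ v → v ∈ l
  member v with Any.any? (v ≟_) l
  ... | yes v∈l = v∈l
  ... | no v∉l  = ⊥-elim (none (v , v∉l))
  inj : ∀ {v w} → Any.index (member v) ≡ Any.index (member w) → v ≡ w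
  inj {v} {w} eq = trans (Any.lookup-index (member v)) 
    (trans (cong (lookup l) eq) (≡-sym (Any.lookup-index (member w))))

unique-++⁻ʳ : (ws : List A) {l : List A} → Unique (ws ++ l) → Unique l
unique-++⁻ʳ []       u       = u
unique-++⁻ʳ (_ ∷ ws) (_ ∷ u) = unique-++⁻ʳ ws u

unique-++⁻ : (ws : List A) {l : List A} → Unique (ws ++ l) → ∀ {s} → s ∈ ws → s ∉ l
unique-++⁻ (w ∷ ws) (≢s ∷ _) (here refl) s∈l = All.lookup ≢s (∈-++⁺ʳ ws s∈l) refl
unique-++⁻ (w ∷ ws) (_ ∷ u)  (there i)   s∈l = unique-++⁻ ws u i s∈l

-- The vertices of `ws` enter from the last to the first, each between the current head and `x`.
-- Every edge replaced on the way therefore ends in `x`, and these are the edges that must be on no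
-- other cycle.
lengthen-cycle-by : (ws : List (Fin n)) {S : List (Fin n)} {L : Edges n} {h m x : Fin n} (t : List (Fin n))
                    {Cs : List (List (Fin n))} → Unique (ws ++ h ∷ m ∷ t ++ [ x ]) →
                    (∀ {s} → s ∈ ws → s ∉ S) → (∀ {s} → s ∈ ws ++ h ∷ m ∷ t → ¬ OnCycle Cs s x) →
                    Config S L ((h ∷ m ∷ t ++ [ x ]) ∷ Cs) →
                    ∃ λ L′ → Config (ws ++ S) L′ ((ws ++ h ∷ m ∷ t ++ [ x ]) ∷ Cs)
lengthen-cycle-by []       t u ∉S ¬x K = _ , K
lengthen-cycle-by (w ∷ ws) {S} {h = h} {m} {x} t {Cs} uu@(_ ∷ u) ∉S ¬x K
  with lengthen-cycle-by ws t u (∉S ∘ there) (¬x ∘ there) K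
... | L′ , K′ = extend ws u K′ (¬x ∘ there)
  where
  w∉ : w ∉ ws ++ S
  w∉ i with ∈-++⁻ ws i
  ... | inj₁ j = Unique.Unique[x∷xs]⇒x∉xs uu (∈-++⁺ˡ j)
  ... | inj₂ j = ∉S (here refl) j
  extend : ∀ vs {L} → Unique (vs ++ h ∷ m ∷ t ++ [ x ]) → Config (ws ++ S) L ((vs ++ h ∷ m ∷ t ++ [ x ]) ∷ Cs) →
           (∀ {s} → s ∈ vs ++ h ∷ m ∷ t → ¬ OnCycle Cs s x) →
           ∃ λ L′ → Config (w ∷ ws ++ S) L′ ((w ∷ vs ++ h ∷ m ∷ t ++ [ x ]) ∷ Cs)
  extend []            u K ¬x = lengthen-cycle t u (¬x (here refl)) K w w∉
  extend (v ∷ [])      u K ¬x = lengthen-cycle (m ∷ t) u (¬x (here refl)) K w w∉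
  extend (v ∷ v′ ∷ vs) u K ¬x =
    subst (λ l → ∃ λ L′ → Config _ L′ ((w ∷ v ∷ v′ ∷ l) ∷ Cs)) assoc
      (lengthen-cycle (vs ++ h ∷ m ∷ t) (subst (λ l → Unique (v ∷ v′ ∷ l)) (≡-sym assoc) u) (¬x (here refl))
        (subst (λ l → Config _ _ ((v ∷ v′ ∷ l) ∷ Cs)) (≡-sym assoc) K) w w∉)
    where
    assoc : (vs ++ h ∷ m ∷ t) ++ [ x ] ≡ vs ++ h ∷ m ∷ t ++ [ x ]
    assoc = ++-assoc vs (h ∷ m ∷ t) [ x ]

-- `C` turned so that `x` comes last: `p q x` is the triangle to which `C` is shortened, and `ws`
-- holds the vertices restored by lengthening, always next to `x`.
record Rotation {n} (C : List (Fin n)) (x : Fin n) : Set where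
  field
    ws  : List (Fin n)
    p q : Fin n
  rotated : List (Fin n)
  rotated = ws ++ p ∷ q ∷ x ∷ []
  triangle : List (Fin n)
  triangle = p ∷ q ∷ x ∷ []
  field
    unique : Unique rotated
    to     : ∀ {s t} → CycleEdge C s t → CycleEdge rotated s t
    from   : ∀ {s t} → CycleEdge rotated s t → CycleEdge C s t
    ∈-from : ∀ {s} → s ∈ rotated → s ∈ C

  triangle-unique : Unique triangle
  triangle-unique = unique-++⁻ʳ ws unique

  p≢x : p ≢ x
  p≢x with (_ ∷ p≢x ∷ []) ∷ _ ← triangle-unique = p≢x
  p≢q : p ≢ q
  p≢q with (p≢q ∷ _) ∷ _ ← triangle-unique = p≢q
  q≢x : q ≢ x
  q≢x with _ ∷ (q≢x ∷ []) ∷ _ ← triangle-unique = q≢x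

  p∈C : p ∈ C
  p∈C = ∈-from (∈-++⁺ʳ ws (here refl))
  q∈C : q ∈ C
  q∈C = ∈-from (∈-++⁺ʳ ws (there (here refl)))
  x∈C : x ∈ C
  x∈C = ∈-from (∈-++⁺ʳ ws (there (there (here refl))))
  ws⊆C : ∀ {s} → s ∈ ws → s ∈ C
  ws⊆C = ∈-from ∘ ∈-++⁺ˡ

  ws∌ : ∀ {s} → s ∈ ws → s ∉ triangle
  ws∌ = unique-++⁻ ws unique

  ws∌x : ∀ {s} → s ∈ ws → s ≢ x
  ws∌x i refl = ws∌ i (there (there (here refl)))

  before : ∀ {s} → s ∈ ws ++ p ∷ q ∷ [] → s ∈ C × s ≢ x
  before i with ∈-++⁻ ws i
  ... | inj₁ j                   = ws⊆C j , ws∌x j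
  ... | inj₂ (here refl)         = p∈C , p≢x
  ... | inj₂ (there (here refl)) = q∈C , q≢x

rotation : {C : List (Fin n)} {x : Fin n} → 3 ≤ length C → Unique C → x ∈ C → Rotation C x
rotation {n} {x = x} long u x∈C with ∈-∃++ x∈C
... | as , bs , refl with split-end 2 (bs ++ as) (ℕ.≤-pred (subst (3 ≤_) (↭-length (++-comm as (x ∷ bs))) long))
... | ws , p ∷ q ∷ [] , eq , refl = record
  { ws = ws ; p = p ; q = q
  ; unique = subst Unique shape (unique-↭ perm u)
  ; to     = Sum.map to′ to′
  ; from   = Sum.map from′ from′
  ; ∈-from = λ i → ∈-resp-↭ (↭-sym perm) (subst (_ ∈_) (≡-sym shape) i) }
  where
  assoc : as ++ x ∷ bs ≡ (as ++ [ x ]) ++ bs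
  assoc = ≡-sym (++-assoc as [ x ] bs)
  shape : bs ++ as ++ [ x ] ≡ ws ++ p ∷ q ∷ x ∷ []
  shape = trans (≡-sym (++-assoc bs as [ x ])) (trans (cong (_++ [ x ]) eq) (++-assoc ws (p ∷ q ∷ []) [ x ]))
  perm : as ++ x ∷ bs ↭ bs ++ as ++ [ x ]
  perm = subst (_↭ bs ++ as ++ [ x ]) (≡-sym assoc) (++-comm (as ++ [ x ]) bs)
  to′ : ∀ {s t} → Consec (closeUp (as ++ x ∷ bs)) s t → Consec (closeUp (ws ++ p ∷ q ∷ x ∷ [])) s t
  to′ e = subst (λ l → Consec (closeUp l) _ _) shape
    (rotate (as ++ [ x ]) (subst (λ l → Consec (closeUp l) _ _) assoc e))
  from′ : ∀ {s t} → Consec (closeUp (ws ++ p ∷ q ∷ x ∷ [])) s t → Consec (closeUp (as ++ x ∷ bs)) s t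
  from′ e = subst (λ l → Consec (closeUp l) _ _) (≡-sym assoc)
    (rotate bs (subst (λ l → Consec (closeUp l) _ _) (≡-sym shape) e))

LongCycle : List (Fin n) → Set
LongCycle C = 3 ≤ length C × Unique C

-- An older cycle with an edge from `x` to another vertex of `C` would put a second vertex of `C`
-- into `S`. So the edges replaced while the triangle grows to `C` are on no older cycle.
add-cycle : {S : List (Fin n)} {L : Edges n} {Cs : List (List (Fin n))} {C : List (Fin n)} {x : Fin n} →
            Config S L Cs → LongCycle C → x ∈ S → x ∈ C → (∀ {s} → s ∈ C → s ∈ S → s ≡ x) →
            ∃₂ λ S′ L′ → Config S′ L′ (C ∷ Cs) × (∀ {s} → s ∈ S′ → s ∈ C ⊎ s ∈ S)
add-cycle {S = S} {C = C} {x} K (long , u) x∈S x∈C only-x =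
  let _ , K₁ = add-triangle K x∈S (new q∈C q≢x) (new p∈C p≢x) (≢-sym p≢q)
      L′ , K₂ = lengthen-cycle-by ws [] unique ws∉
                  (λ i o → let s∈C , s≢x = before i in new s∈C s≢x (Config.onCycle⇒∈S K o)) K₁
  in _ , L′ , config-cong from to K₂ , origin
  where
  open Rotation (rotation long u x∈C)
  new : ∀ {s} → s ∈ C → s ≢ x → s ∉ S
  new s∈C s≢x s∈S = s≢x (only-x s∈C s∈S)
  ws∉ : ∀ {s} → s ∈ ws → s ∉ p ∷ q ∷ S
  ws∉ i (here refl)         = ws∌ i (here refl)
  ws∉ i (there (here refl)) = ws∌ i (there (here refl))
  ws∉ i (there (there j))   = new (ws⊆C i) (ws∌x i) j
  origin : ∀ {s} → s ∈ ws ++ p ∷ q ∷ S → s ∈ C ⊎ s ∈ S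
  origin i with ∈-++⁻ ws i
  ... | inj₁ j                   = inj₁ (ws⊆C j)
  ... | inj₂ (here refl)         = inj₁ p∈C
  ... | inj₂ (there (here refl)) = inj₁ q∈C
  ... | inj₂ (there (there j))   = inj₂ j

-- Meeting and disjoint pairs are handled at once: `shared` says that a common vertex must be the
-- one at which both rotations end, and it is vacuous for disjoint cycles.
join-pair : {C₂ C₁ : List (Fin n)} {x₂ x₁ : Fin n} (r₂ : Rotation C₂ x₂) (r₁ : Rotation C₁ x₁) →
            (∀ {s} → s ∈ C₂ → s ∈ C₁ → s ≡ x₂ × s ≡ x₁) → {S : List (Fin n)} {L : Edges n} →
            (∀ {s} → s ∈ S → s ∈ Rotation.triangle r₂ ⊎ s ∈ Rotation.triangle r₁) →
            Config S L (Rotation.triangle r₂ ∷ Rotation.triangle r₁ ∷ []) →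
            ∃₂ λ S′ L′ → Config S′ L′ (C₂ ∷ C₁ ∷ []) × (∀ {s} → s ∈ S′ → Any (s ∈_) (C₂ ∷ C₁ ∷ []))
join-pair {C₂ = C₂} {C₁} {x₂} {x₁} r₂ r₁ shared {S} S⊆ K =
  let _ , K₂ = lengthen-cycle-by R₂.ws [] R₂.unique ws₂∉ ¬x₂ K
      L′ , K₁ = lengthen-cycle-by R₁.ws [] R₁.unique ws₁∉ ¬x₁ (config-swap K₂)
  in _ , L′ , config-cong R₂.from R₂.to (config-swap (config-cong R₁.from R₁.to K₁)) , origin
  where
  module R₂ = Rotation r₂
  module R₁ = Rotation r₁
  in₂ : ∀ {s} → s ∈ R₂.triangle → s ∈ C₂
  in₂ = R₂.∈-from ∘ ∈-++⁺ʳ R₂.ws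
  in₁ : ∀ {s} → s ∈ R₁.triangle → s ∈ C₁
  in₁ = R₁.∈-from ∘ ∈-++⁺ʳ R₁.ws
  ws₂∉ : ∀ {s} → s ∈ R₂.ws → s ∉ S
  ws₂∉ i j with S⊆ j
  ... | inj₁ k = R₂.ws∌ i k
  ... | inj₂ k = R₂.ws∌x i (proj₁ (shared (R₂.ws⊆C i) (in₁ k)))
  ws₁∉ : ∀ {s} → s ∈ R₁.ws → s ∉ R₂.ws ++ S
  ws₁∉ i j with ∈-++⁻ R₂.ws j
  ... | inj₁ k = R₁.ws∌x i (proj₂ (shared (R₂.ws⊆C k) (R₁.ws⊆C i)))
  ... | inj₂ k with S⊆ k
  ...   | inj₁ k′ = R₁.ws∌x i (proj₂ (shared (in₂ k′) (R₁.ws⊆C i)))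
  ...   | inj₂ k′ = R₁.ws∌ i k′
  ¬x₂ : ∀ {s} → s ∈ R₂.ws ++ R₂.p ∷ R₂.q ∷ [] → ¬ OnCycle (R₁.triangle ∷ []) s x₂
  ¬x₂ i (here e) = let s∈C₂ , s≢x₂ = R₂.before i in s≢x₂ (proj₁ (shared s∈C₂ (in₁ (cycleEdge-∈ˡ e))))
  ¬x₁ : ∀ {s} → s ∈ R₁.ws ++ R₁.p ∷ R₁.q ∷ [] → ¬ OnCycle (R₂.rotated ∷ []) s x₁
  ¬x₁ i (here e) = let s∈C₁ , s≢x₁ = R₁.before i in s≢x₁ (proj₂ (shared (R₂.∈-from (cycleEdge-∈ˡ e)) s∈C₁))
  origin : ∀ {s} → s ∈ R₁.ws ++ R₂.ws ++ S → Any (s ∈_) (C₂ ∷ C₁ ∷ [])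
  origin i with ∈-++⁻ R₁.ws i
  ... | inj₁ j = there (here (R₁.ws⊆C j))
  ... | inj₂ j with ∈-++⁻ R₂.ws j
  ...   | inj₁ k = here (R₂.ws⊆C k)
  ...   | inj₂ k with S⊆ k
  ...     | inj₁ k′ = here (in₂ k′)
  ...     | inj₂ k′ = there (here (in₁ k′))

build-pair : {C₂ C₁ : List (Fin n)} → LongCycle C₂ → LongCycle C₁ → AtMostOneShared C₂ (C₁ ∷ []) →
             ∃₂ λ S L → Config S L (C₂ ∷ C₁ ∷ []) × (∀ {s} → s ∈ S → Any (s ∈_) (C₂ ∷ C₁ ∷ []))
build-pair {C₂ = C₂} {C₁} (long₂ , u₂) (long₁ , u₁) ≤1 with Any.any? (λ s → Any.any? (s ≟_) C₁) C₂
build-pair {C₂ = C₂} {C₁} (long₂ , u₂) (long₁ , u₁) ≤1 | yes x∈ =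
  join-pair r₂ r₁ shared S⊆ (proj₂ (relabel-by _ _ vs-unique bowtie-in-K₅⁻))
  where
  x = Any.lookup x∈
  x∈C₂ : x ∈ C₂
  x∈C₂ = ∈-lookup (Any.index x∈)
  x∈C₁ : x ∈ C₁
  x∈C₁ = Any.lookup-result x∈
  r₂ : Rotation C₂ x
  r₂ = rotation long₂ u₂ x∈C₂
  r₁ : Rotation C₁ x
  r₁ = rotation long₁ u₁ x∈C₁
  module R₂ = Rotation r₂
  module R₁ = Rotation r₁
  shared : ∀ {s} → s ∈ C₂ → s ∈ C₁ → s ≡ x × s ≡ x
  shared i j = let eq = ≤1 _ _ i x∈C₂ (here j) (here x∈C₁) in eq , eq
  differ : ∀ {s t} → s ∈ C₂ → t ∈ C₁ → t ≢ x → s ≢ t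
  differ i j t≢x refl = t≢x (proj₁ (shared i j))
  vs : List (Fin _)
  -- Ordered so that `1 3 0` and `2 4 0` of the bowtie become the triangles of `r₂` and `r₁`.
  vs = x ∷ R₂.p ∷ R₁.p ∷ R₂.q ∷ R₁.q ∷ []
  vs-unique : Unique vs
  vs-unique = (≢-sym R₂.p≢x ∷ ≢-sym R₁.p≢x ∷ ≢-sym R₂.q≢x ∷ ≢-sym R₁.q≢x ∷ [])
    ∷ (differ R₂.p∈C R₁.p∈C R₁.p≢x ∷ R₂.p≢q ∷ differ R₂.p∈C R₁.q∈C R₁.q≢x ∷ [])
    ∷ (≢-sym (differ R₂.q∈C R₁.p∈C R₁.p≢x) ∷ R₁.p≢q ∷ [])
    ∷ (differ R₂.q∈C R₁.q∈C R₁.q≢x ∷ []) ∷ [] ∷ []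
  S⊆ : ∀ {s} → s ∈ vs → s ∈ R₂.triangle ⊎ s ∈ R₁.triangle
  S⊆ (here eq)                                 = inj₁ (there (there (here eq)))
  S⊆ (there (here eq))                         = inj₁ (here eq)
  S⊆ (there (there (here eq)))                 = inj₂ (here eq)
  S⊆ (there (there (there (here eq))))         = inj₁ (there (here eq))
  S⊆ (there (there (there (there (here eq))))) = inj₂ (there (here eq))
build-pair {C₂ = C₂@(x₂ ∷ _)} {C₁@(x₁ ∷ _)} (long₂ , u₂) (long₁ , u₁) ≤1 | no disjoint =
  join-pair r₂ r₁ shared S⊆ (proj₂ (relabel-by _ _ vs-unique disjoint-triangles))
  where
  r₂ : Rotation C₂ x₂
  r₂ = rotation long₂ u₂ (here refl)
  r₁ : Rotation C₁ x₁
  r₁ = rotation long₁ u₁ (here refl)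
  module R₂ = Rotation r₂
  module R₁ = Rotation r₁
  apart : ∀ {s} → s ∈ C₂ → s ∉ C₁
  apart i j = disjoint (Any.map (λ { refl → j }) i)
  shared : ∀ {s} → s ∈ C₂ → s ∈ C₁ → s ≡ x₂ × s ≡ x₁
  shared i j = ⊥-elim (apart i j)
  vs : List (Fin _)
  vs = R₂.triangle ++ R₁.triangle
  vs-unique : Unique vs
  vs-unique = Unique.++⁺ R₂.triangle-unique R₁.triangle-unique
    λ (i , j) → apart (R₂.∈-from (∈-++⁺ʳ R₂.ws i)) (R₁.∈-from (∈-++⁺ʳ R₁.ws j))
  S⊆ : ∀ {s} → s ∈ vs → s ∈ R₂.triangle ⊎ s ∈ R₁.triangle
  S⊆ = ∈-++⁻ R₂.triangle

build-many : (C₂ C₁ : List (Fin n)) (Cs : List (List (Fin n))) →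
             All LongCycle (C₂ ∷ C₁ ∷ Cs) → WellBuilt (C₂ ∷ C₁ ∷ Cs) →
             ∃₂ λ S L → Config S L (C₂ ∷ C₁ ∷ Cs) × (∀ {s} → s ∈ S → Any (s ∈_) (C₂ ∷ C₁ ∷ Cs))
build-many C₂ C₁ []        (long₂ ∷ long₁ ∷ []) (≤1 , _)  = build-pair long₂ long₁ ≤1
build-many C  C₂ (C₁ ∷ Cs) (long ∷ longs)       (≤1 , wb) with build-many C₂ C₁ Cs longs wb
... | S , L , K , S⊆ = attach (Any.any? (λ s → Any.any? (s ≟_) S) C)
  where
  Result : Set
  Result = ∃₂ λ S L → Config S L (C ∷ C₂ ∷ C₁ ∷ Cs) × (∀ {s} → s ∈ S → Any (s ∈_) (C ∷ C₂ ∷ C₁ ∷ Cs))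
  head∈ : ∀ {C : List (Fin _)} → 3 ≤ length C → ∃ (_∈ C)
  head∈ {x ∷ _} _ = x , here refl
  attach : Dec (Any (_∈ S) C) → Result
  attach (yes x∈) =
    let x∈C = ∈-lookup (Any.index x∈)
        x∈S = Any.lookup-result x∈
        S′ , L′ , K′ , origin = add-cycle K long x∈S x∈C (λ s∈C s∈S → ≤1 _ _ s∈C x∈C (S⊆ s∈S) (S⊆ x∈S))
    in S′ , L′ , K′ , λ i → [ here , there ∘ S⊆ ]′ (origin i)
  -- The next cycle misses everything built so far: one of its vertices is added off the family, and
  -- the cycle is then attached there.
  attach (no none) =
    let x , x∈C = head∈ (proj₁ long)
        apart : ∀ {s} → s ∈ C → s ∉ S
        apart i j = none (Any.map (λ { refl → j }) i)
        _ , K₁ = add-vertex K x (apart x∈C)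
        only-x : ∀ {s} → s ∈ C → s ∈ x ∷ S → s ≡ x
        only-x = λ { _ (here eq) → eq ; i (there j) → ⊥-elim (apart i j) }
        S′ , L′ , K′ , origin = add-cycle K₁ long (here refl) x∈C only-x
    in S′ , L′ , K′ , λ i → [ here , (λ { (here refl) → here x∈C ; (there j) → there (S⊆ j) }) ]′ (origin i)

-- A triangle or a square leaves two or one of the five vertices outside, taken from `fresh`.
-- Lengths three, four and five each have their own place in `K₅⁻`, since lengthening a triangle
-- there would spend six vertices on a square.
build-one : 5 ≤ n → (C : List (Fin n)) → LongCycle C → ∃₂ λ S L → Config S L (C ∷ [])
build-one 5≤n (_ ∷ [])         (s≤s () , _)
build-one 5≤n (_ ∷ _ ∷ [])     (s≤s (s≤s ()) , _)
build-one 5≤n C@(a ∷ b ∷ c ∷ [])     (_ , u) =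
  let d , d∉ = fresh C (ℕ.≤-trans (ℕ.n≤1+n 4) 5≤n)
      e , e∉ = fresh (d ∷ C) 5≤n
      vs = C ++ d ∷ e ∷ []
      vs-unique : Unique vs
      vs-unique = Unique.++⁺ u ((≢-sym (λ eq → e∉ (here eq)) ∷ []) ∷ [] ∷ [])
        λ { (i , here refl) → d∉ i ; (i , there (here refl)) → e∉ (there i) }
  in _ , relabel-by _ _ vs-unique triangle-in-K₅⁻
build-one 5≤n C@(a ∷ b ∷ c ∷ d ∷ []) (_ , u) =
  let e , e∉ = fresh C 5≤n
      vs = C ++ e ∷ []
      vs-unique : Unique vs
      vs-unique = Unique.++⁺ u ([] ∷ []) λ { (i , here refl) → e∉ i }
  in _ , relabel-by _ _ vs-unique square-in-K₅⁻
build-one {n} 5≤n C@(_ ∷ _ ∷ _ ∷ _ ∷ _ ∷ _) (_ , u) with split-end 5 C (s≤s (s≤s (s≤s (s≤s (s≤s z≤n)))))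
... | ws , a ∷ b ∷ c ∷ d ∷ e ∷ [] , eq , _ =
  let L , K = lengthen-cycle-by ws (c ∷ d ∷ []) u′ ws∉ (λ _ ())
                (proj₂ (relabel-by _ _ vs-unique pentagon-in-K₅⁻))
  in ws ++ vs , L , subst (λ C → Config (ws ++ vs) L (C ∷ [])) (≡-sym eq) K
  where
  vs : List (Fin n)
  -- Ordered so that the pentagon `3 0 4 1 2` reads `a b c d e`; the missing edge `34` becomes the
  -- chord `ac`.
  vs = b ∷ d ∷ e ∷ a ∷ c ∷ []
  u′ : Unique (ws ++ a ∷ b ∷ c ∷ d ∷ e ∷ [])
  u′ = subst Unique eq u
  perm : a ∷ b ∷ c ∷ d ∷ e ∷ [] ↭ vs
  perm = ↭.trans (++-comm (a ∷ []) (b ∷ c ∷ d ∷ e ∷ [])) (↭.prep b (++-comm (c ∷ []) (d ∷ e ∷ a ∷ [])))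
  vs-unique : Unique vs
  vs-unique = unique-↭ perm (unique-++⁻ʳ ws u′)
  ws∉ : ∀ {s} → s ∈ ws → s ∉ vs
  ws∉ i j = unique-++⁻ ws u′ i (∈-resp-↭ (↭-sym perm) j)

fill : {S : List (Fin n)} {L : Edges n} {Cs : List (List (Fin n))} → Config S L Cs → (l : List (Fin n)) →
       ∃₂ λ S′ L′ → Config S′ L′ Cs × (∀ {s} → s ∈ l → s ∈ S′)
fill {S = S} {L} K [] = S , L , K , λ ()
fill K (v ∷ l) with S , L , K₁ , l⊆ ← fill K l with Any.any? (v ≟_) S
... | yes v∈ = S , L , K₁ , λ { (here refl) → v∈ ; (there i) → l⊆ i }
... | no v∉  = let L′ , K₂ = add-vertex K₁ v v∉ in
  v ∷ S , L′ , K₂ , λ { (here refl) → here refl ; (there i) → there (l⊆ i) }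

build : 5 ≤ n → (Cs : List (List (Fin n))) → 1 ≤ length Cs → All LongCycle Cs → WellBuilt Cs →
        ∃₂ λ S L → Config S L Cs × (∀ v → v ∈ S)
build {n} 5≤n Cs 1≤ long wb =
  let _ , _ , K = some Cs 1≤ long wb
      S , L , K′ , all∈ = fill K (allFin n)
  in S , L , K′ , λ v → all∈ (∈-allFin v)
  where
  some : ∀ Cs → 1 ≤ length Cs → All LongCycle Cs → WellBuilt Cs → ∃₂ λ S L → Config S L Cs
  some (C ∷ [])       _ (long ∷ []) _  = build-one 5≤n C long
  some (C₂ ∷ C₁ ∷ Cs) _ longs       wb = let S , L , K , _ = build-many C₂ C₁ Cs longs wb in S , L , K

-- From configurations to graphs

does⁻ : {a? : Dec A} → does a? ≡ true → A
does⁻ {a? = yes a} _ = a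

does⁺ : {a? : Dec A} → A → does a? ≡ true
does⁺ {a? = a?} = dec-true a?

pullback : {m : ℕ} → (Fin m → Fin n) → SymColouring n → SymColouring m
pullback φ (c , c-sym) = (λ u v → c (φ u) (φ v)) , λ u v → c-sym (φ u) (φ v)

isCycle⇒cycle : {G : Graph n} {c : SymColouring n} {D : List (Fin n)} → IsCycle G D → Monochromatic c D →
                ∃ λ b → Cycle (Class (E G) c b) D
isCycle⇒cycle {D = x ∷ xs} (long , u , linked) (b , mono) = b , record
  { long = s≤s long ; unique = u ; steps = λ e → linked⇒consec linked e , linked⇒consec mono e }

cycle⇒isCycle : {G : Graph n} {c : SymColouring n} {b : Bool} {D : List (Fin n)} → Cycle (Class (E G) c b) D →
                IsCycle G D × Monochromatic c D
cycle⇒isCycle {D = []}     cyc with () ← Cycle.long cyc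
cycle⇒isCycle {b = b} {x ∷ xs} cyc =
  (ℕ.≤-pred long , unique , consec⇒linked _ (proj₁ ∘ steps)) , b , consec⇒linked _ (proj₂ ∘ steps)
  where open Cycle cyc

module _ {S : List (Fin n)} {L : Edges n} (core : Core S L) (all∈S : ∀ v → v ∈ S) where

  open Core core

  toGraph : Graph n
  toGraph = record
    { adj    = λ p q → does (adj? L p q)
    ; sym    = λ p q → does-⇔ (mk⇔ swap swap) (adj? L p q) (adj? L q p)
    ; irrefl = λ p → dec-false (adj? L p p) (λ e → irreflexive e refl) }

  edge⁻ : ∀ {p q} → E toGraph p q → Adj L p q
  edge⁻ {p} {q} = does⁻ {a? = adj? L p q}

  edge⁺ : ∀ {p q} → Adj L p q → E toGraph p q
  edge⁺ {p} {q} = does⁺ {a? = adj? L p q}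

  inR : InR toGraph
  inR c =
    let b , D , cyc = two-colouring⇒cycle S L simple closed count c
    in D , cycle⇒isCycle {G = toGraph} {c} {b} (cycle-mono (λ _ _ (e , eq) → edge⁺ e , eq) cyc)

  -- A proper subgraph misses some edge `pq`: if it misses a vertex, `covered` gives an edge there.
  -- The colouring without monochromatic cycles of the graph minus `pq` is then pulled back to `H`.
  no-proper-subgraph : ∀ m (H : Graph m) (φ : Fin m → Fin n) →
                       IsSubgraphVia H toGraph φ → ProperVia H toGraph φ → ¬ InR H
  no-proper-subgraph m H φ (φ-injective , φ-hom) proper H∈R with missing proper
    where
    missing : ProperVia H toGraph φ →
              ∃₂ λ p q → Adj L p q × (∀ {u v} → E H u v → ¬ Same p q (φ u) (φ v))
    missing (inj₁ (w , w∉φ)) = let q , e = covered (all∈S w) in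
      w , q , e , λ { _ (inj₁ (eq , _)) → w∉φ _ eq ; _ (inj₂ (_ , eq)) → w∉φ _ eq }
    missing (inj₂ (u , v , ¬uv , e)) = φ u , φ v , edge⁻ e , distinct
      where
      false≢true : false ≢ true
      false≢true ()
      distinct : ∀ {u′ v′} → E H u′ v′ → ¬ Same (φ u) (φ v) (φ u′) (φ v′)
      distinct e′ (inj₁ (eq₁ , eq₂)) with refl ← φ-injective _ _ eq₁ | refl ← φ-injective _ _ eq₂ =
        false≢true (trans (≡-sym ¬uv) e′)
      distinct e′ (inj₂ (eq₁ , eq₂)) with refl ← φ-injective _ _ eq₁ | refl ← φ-injective _ _ eq₂ =
        false≢true (trans (≡-sym ¬uv) (trans (Graph.sym H u v) e′))
  ... | p , q , e , avoids with critical e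
  ...   | c , good with H∈R (pullback φ c)
  ...     | D , isCycle , mono with isCycle⇒cycle {G = H} {pullback φ c} isCycle mono
  ...       | b , cyc with () ← good (cycle-map {R′ = Class (Adj L ∖ (p , q)) c b} φ (λ _ _ → φ-injective _ _)
                                       (λ (h , eq) → (edge⁻ (φ-hom _ _ h) , avoids h) , eq) cyc)

  inM : InM toGraph
  inM = inR , no-proper-subgraph

longCycle : {G : Graph n} {C : List (Fin n)} → IsCycle G C → LongCycle C
longCycle {C = x ∷ xs} (long , u , _) = s≤s long , u

-- Transport of a family of cycles along an injection

module _ {m n : ℕ} (φ : Fin m → Fin n) (φ-injective : ∀ {u v} → φ u ≡ φ v → u ≡ v) where

  longCycle-map : {C : List (Fin m)} → LongCycle C → LongCycle (map φ C)
  longCycle-map {C} (long , u) = subst (3 ≤_) (≡-sym (length-map φ C)) long , Unique.map⁺ φ-injective u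

  ∈-map-injective : {C : List (Fin m)} {u : Fin m} → φ u ∈ map φ C → u ∈ C
  ∈-map-injective i with _ , j , eq ← ∈-map⁻ φ i with refl ← φ-injective eq = j

  wellBuilt-map : (Cs : List (List (Fin m))) → WellBuilt Cs → WellBuilt (map (map φ) Cs)
  wellBuilt-map []       _          = tt
  wellBuilt-map (C ∷ Cs) (≤1 , wb) = ≤1′ , wellBuilt-map Cs wb
    where
    ≤1′ : AtMostOneShared (map φ C) (map (map φ) Cs)
    ≤1′ _ _ i j o o′ with u , i′ , refl ← ∈-map⁻ φ i | v , j′ , refl ← ∈-map⁻ φ j =
      cong φ (≤1 u v i′ j′ (Any.map ∈-map-injective (Any.map⁻ o)) (Any.map ∈-map-injective (Any.map⁻ o′)))

  -- On the edges of the cycles, a cycle-monochromatic colouring is determined by one colour per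
  -- cycle, so any colouring that realises this palette extends it.
  monochromatic-palette : (c : SymColouring m) (Cs : List (List (Fin m))) → All (Monochromatic c) Cs →
                          Σ (Palette (map (map φ) Cs)) λ β → ∀ c′ → Paints c′ (map (map φ) Cs) β →
                            ∀ {u v} → OnCycle Cs u v → col c′ (φ u) (φ v) ≡ col c u v
  monochromatic-palette c []       []                   = [] , λ _ _ ()
  monochromatic-palette c (C ∷ Cs) ((b , mono) ∷ monos) with monochromatic-palette c Cs monos
  ... | β , agree = b ∷ β , agree′
    where
    coloured : ∀ {u v} → CycleEdge C u v → col c u v ≡ b
    coloured (inj₁ e) = linked⇒consec mono e
    coloured (inj₂ e) = trans (proj₂ c _ _) (linked⇒consec mono e)
    agree′ : ∀ c′ → Paints c′ (map (map φ) (C ∷ Cs)) (b ∷ β) →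
             ∀ {u v} → OnCycle (C ∷ Cs) u v → col c′ (φ u) (φ v) ≡ col c u v
    agree′ c′ (eq , _)  (here e)  = trans (eq (cycleEdge-map⁺ φ e)) (≡-sym (coloured e))
    agree′ c′ (_ , ps) (there o) = agree c′ ps o

theorem1p8 : ∀ (m : ℕ) (F : ForestOfCycles m) (n : ℕ) → 5 ≤ n → m ≤ n →
    Σ (Graph n) λ G → InM G ×
    Σ (Fin m → Fin n) λ φ → IsSubgraphVia (graph F) G φ ×
    (∀ (cF : SymColouring m) → CycleMonochromatic F cF →
    Σ (SymColouring n) λ c →
    (∀ u v → E (graph F) u v → col c (φ u) (φ v) ≡ col cF u v) ×
    (∀ D → IsCycle G D → Monochromatic c D →
    Any (λ C → ∀ x y → Consec (closeUp D) x y →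
    ∃₂ λ u v → CycleEdge C u v × φ u ≡ x × φ v ≡ y)
    (cycles F)))
theorem1p8 m F n 5≤n m≤n
  with build 5≤n (map (map (λ i → inject≤ i m≤n)) (cycles F))
         (subst (1 ≤_) (≡-sym (length-map _ (cycles F))) (nonempty F))
         (All.map⁺ (All.map (longCycle-map (λ i → inject≤ i m≤n) (inject≤-injective m≤n m≤n _ _)
                             ∘ longCycle {G = graph F})
                            (areCycles F)))
         (wellBuilt-map (λ i → inject≤ i m≤n) (inject≤-injective m≤n m≤n _ _) (cycles F) (built F))
... | S , L , K , all∈S = G , inM core all∈S , φ , ((λ _ _ → φ-injective) , λ _ _ → φ-hom) , λ cF mono →
  let β , agree    = monochromatic-palette φ φ-injective cF (cycles F) mono
      c , ps , good = paint β
  in c , (λ u v e → agree c ps (edges F u v e)) , λ D isCycle monoD →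
       let b , cyc = isCycle⇒cycle {G = G} {c} isCycle monoD
       in Any.map (λ {C} D⊑ x y e → cycleEdge-map⁻ φ C (D⊑ e))
            (Any.map⁻ (good (cycle-mono (λ _ _ (e , eq) → edge⁻ core all∈S e , eq) cyc)))
  where
  open Config K
  φ : Fin m → Fin n
  φ i = inject≤ i m≤n
  φ-injective : ∀ {u v} → φ u ≡ φ v → u ≡ v
  φ-injective = inject≤-injective m≤n m≤n _ _
  G : Graph n
  G = toGraph core all∈S
  φ-hom : ∀ {u v} → E (graph F) u v → E G (φ u) (φ v)
  φ-hom e = edge⁺ core all∈S (contained (Any.map⁺ (Any.map (cycleEdge-map⁺ φ) (edges F _ _ e))))
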